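{- Let $s\in\mathbb{N}$ and $p\in\mathbb{N}'$. The $Z$ transform of the sequence $n\mapsto\binom{n}{p}_{F_s}$ is $$\mathcal{Z}\left(\binom{n}{p}_{F_s}\right)=\frac{(-1)^{s+1}z}{\displaystyle\sum_{i=0}^{p+1}(-1)^{\frac{(si+2(s+1))(i+1)}{2}}\binom{p+1}{i}_{F_s}y^{\frac{si(i-1)}{2}}z^{p+1-i}}.$$
   Context: $\mathbb{N}=\{1,2,\dots\}$, $\mathbb{N}'=\mathbb{N}\cup\{0\}$. $x,y$ are indeterminates and we abbreviate $F_n=F_n(x,y)$. The bivariate Fibonacci polynomials are $F_0=0$, $F_1=1$, $F_{n+2}=xF_{n+1}+yF_n$. For $n,k\in\mathbb{N}'$ the bivariate $s$-Fibopolynomial is $\binom{n}{k}_{F_s}=\frac{F_{sn}F_{s(n-1)}\cdots F_{s(n-k+1)}}{F_sF_{2s}\cdots F_{ks}}$ (equal to $1$ for $k=0$ and $k=n$, and to $0$ if $k>n$). The $Z$ transform of a sequence $(a_n)_{n\ge0}$ is $\mathcal{Z}(a_n)=\sum_{n\ge0}a_nz^{ -n}$, regarded as a formal power series in $z^{ -1}$ with coefficients in $\mathbb{C}(x,y)$ (equivalently, for fixed complex $x,y$, as a function of $z$ for $|z|$ large). -}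

module Defs where

open import Algebra.Bundles using (CommutativeRing)
open import Algebra.Core using (Op₁; Op₂)
open import Algebra.Structures using (IsCommutativeRing)
open import Algebra.Definitions using
  (Congruent₁; Congruent₂; Associative; Commutative; LeftIdentity; LeftInverse; _DistributesOverʳ_)
import Algebra.Properties.Monoid.Sum as MonoidSum
import Algebra.Properties.Ring as RingProperties
import Algebra.Properties.Semiring.Exp as Exp
import Algebra.Consequences.Setoid as Consequences
import Algebra.Solver.Ring.NaturalCoefficients.Default as SemiringSolver
open import Data.Bool.Base using (if_then_else_)
open import Data.Fin.Base using (Fin; zero; suc; toℕ)
open import Data.Nat.Base as ℕ using (ℕ; zero; suc; NonZero; _∸_; _≤ᵇ_; z≤n; s≤s)
import Data.Nat.Properties as ℕₚ
open import Data.Product.Base using (Σ-syntax; ∃-syntax; _×_; _,_; proj₁; proj₂)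
open import Data.Rational.Base as ℚ using (ℚ; 0ℚ; 1ℚ; ½; ∣_∣; 1/_)
import Data.Rational.Properties as ℚₚ
import Data.Rational.Solver as ℚSolver
open import Data.Vec.Functional using (Vector)
open import Function.Base using (_∘_)
open import Level using (Level; _⊔_; 0ℓ)
open import Relation.Binary.Bundles using (Setoid)
open import Relation.Binary.Core using (Rel)
open import Relation.Binary.PropositionalEquality as ≡ using (_≡_)
open import Relation.Binary.Structures using (IsEquivalence)
import Relation.Binary.Reasoning.Setoid as SetoidReasoning

private
  variable
    c ℓ : Level

  mkIsCommutativeRing :
    {A : Set c} {_≈_ : Rel A ℓ} {_+_ _*_ : Op₂ A} { -_ : Op₁ A} {0# 1# : A} →
    IsEquivalence _≈_ →
    Congruent₂ _≈_ _+_ → Associative _≈_ _+_ → Commutative _≈_ _+_ → LeftIdentity _≈_ 0# _+_ →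
    Congruent₁ _≈_ -_ → LeftInverse _≈_ 0# -_ _+_ →
    Congruent₂ _≈_ _*_ → Associative _≈_ _*_ → Commutative _≈_ _*_ → LeftIdentity _≈_ 1# _*_ →
    _DistributesOverʳ_ _≈_ _*_ _+_ →
    IsCommutativeRing _≈_ _+_ _*_ -_ 0# 1#
  mkIsCommutativeRing
    ≈-equiv +-cong +-assoc +-comm +-idˡ -‿cong -‿invˡ *-cong *-assoc *-comm *-idˡ distribʳ = record
    { isRing = record
      { +-isAbelianGroup = record
        { isGroup = record
          { isMonoid = record
            { isSemigroup = record
              { isMagma = record { isEquivalence = ≈-equiv ; ∙-cong = +-cong }
              ; assoc = +-assoc
              }
            ; identity = C.comm∧idˡ⇒id +-comm +-idˡ
            }
          ; inverse = C.comm∧invˡ⇒inv +-comm -‿invˡ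
          ; ⁻¹-cong = -‿cong
          }
        ; comm = +-comm
        }
      ; *-cong = *-cong
      ; *-assoc = *-assoc
      ; *-identity = C.comm∧idˡ⇒id *-comm *-idˡ
      ; distrib = C.comm∧distrʳ⇒distr +-cong *-comm distribʳ
      }
    ; *-comm = *-comm
    }
    where
    setoid : Setoid _ _
    setoid = record { isEquivalence = ≈-equiv }
    module C = Consequences setoid

  left⊔ : ∀ a b {m} → a ℕ.⊔ b ℕ.≤ m → a ℕ.≤ m
  left⊔ a b = ℕₚ.≤-trans (ℕₚ.m≤m⊔n a b)

  right⊔ : ∀ a b {m} → a ℕ.⊔ b ℕ.≤ m → b ℕ.≤ m
  right⊔ a b = ℕₚ.≤-trans (ℕₚ.m≤n⊔m a b)

module Complex where

  -- Reflexivity at f is the Cauchy condition on f.  Between Cauchy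
  -- sequences, f ∼ g holds exactly when f − g tends to 0.
  infix 4 _∼_
  record _∼_ (f g : ℕ → ℚ) : Set where
    no-eta-equality
    field
      close : ∀ ε → 0ℚ ℚ.< ε →
        ∃[ N ] ∀ m n → N ℕ.≤ m → N ℕ.≤ n → ∣ f m ℚ.- g n ∣ ℚ.< ε

  open _∼_

  record ℝ : Set where
    constructor real
    field
      seq    : ℕ → ℚ
      cauchy : seq ∼ seq

  open ℝ

  infix 4 _≈ᴿ_
  record _≈ᴿ_ (x y : ℝ) : Set where
    constructor eqᴿ
    field seq∼ : seq x ∼ seq y

  open _≈ᴿ_

  private
    open ℚSolver.+-*-Solver

    half+half : ∀ ε → ½ ℚ.* ε ℚ.+ ½ ℚ.* ε ≡ ε
    half+half = solve 1 (λ e → con ½ :* e :+ con ½ :* e := e) ≡.refl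

    half>0 : ∀ {ε} → 0ℚ ℚ.< ε → 0ℚ ℚ.< ½ ℚ.* ε
    half>0 {ε} ε>0 = ℚₚ.positive⁻¹ (½ ℚ.* ε) {{ℚₚ.pos*pos⇒pos ½ ε {{ℚ.positive ε>0}}}}

    add-halves : ∀ {ε d} a b → d ≡ a ℚ.+ b →
                 ∣ a ∣ ℚ.< ½ ℚ.* ε → ∣ b ∣ ℚ.< ½ ℚ.* ε → ∣ d ∣ ℚ.< ε
    add-halves {ε} a b ≡.refl a< b< = ℚₚ.≤-<-trans (ℚₚ.∣p+q∣≤∣p∣+∣q∣ a b)
      (≡.subst (∣ a ∣ ℚ.+ ∣ b ∣ ℚ.<_) (half+half ε) (ℚₚ.+-mono-< a< b<))

    ∼-sym : ∀ {f g} → f ∼ g → g ∼ f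
    ∼-sym {f} {g} f∼g .close ε ε>0 with close f∼g ε ε>0
    ... | N , h = N , λ m n N≤m N≤n →
      ≡.subst (ℚ._< ε)
        (≡.trans (≡.sym (ℚₚ.∣-p∣≡∣p∣ _))
                 (≡.cong ∣_∣ (solve 2 (λ a b → :- (a :- b) := b :- a) ≡.refl (f n) (g m))))
        (h n m N≤n N≤m)

    ∼-trans : ∀ {f g h} → f ∼ g → g ∼ h → f ∼ h
    ∼-trans {f} {g} {h} f∼g g∼h .close ε ε>0 with close f∼g (½ ℚ.* ε) (half>0 ε>0) | close g∼h (½ ℚ.* ε) (half>0 ε>0)
    ... | N , p | M , q = N ℕ.⊔ M , λ m n N≤m N≤n →
      add-halves (f m ℚ.- g (N ℕ.⊔ M)) (g (N ℕ.⊔ M) ℚ.- h n)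
        (solve 3 (λ a b c → a :- c := (a :- b) :+ (b :- c)) ≡.refl (f m) _ (h n))
        (p m _ (left⊔ N M N≤m) (ℕₚ.m≤m⊔n N M)) (q _ n (ℕₚ.m≤n⊔m N M) (right⊔ N M N≤n))

    ∼-≗ : ∀ {f g h} → f ∼ g → (∀ n → g n ≡ h n) → f ∼ h
    ∼-≗ {f} f∼g g≗h .close ε ε>0 with close f∼g ε ε>0
    ... | N , p = N , λ m n N≤m N≤n → ≡.subst (λ t → ∣ f m ℚ.- t ∣ ℚ.< ε) (g≗h n) (p m n N≤m N≤n)

    ∼-+ : ∀ {f f′ g g′} → f ∼ f′ → g ∼ g′ → (λ n → f n ℚ.+ g n) ∼ (λ n → f′ n ℚ.+ g′ n)
    ∼-+ {f} {f′} {g} {g′} f∼f′ g∼g′ .close ε ε>0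
      with close f∼f′ (½ ℚ.* ε) (half>0 ε>0) | close g∼g′ (½ ℚ.* ε) (half>0 ε>0)
    ... | N , p | M , q = N ℕ.⊔ M , λ m n N≤m N≤n →
      add-halves (f m ℚ.- f′ n) (g m ℚ.- g′ n)
        (solve 4 (λ a b c d → (a :+ c) :- (b :+ d) := (a :- b) :+ (c :- d)) ≡.refl
          (f m) (f′ n) (g m) (g′ n))
        (p m n (left⊔ N M N≤m) (left⊔ N M N≤n)) (q m n (right⊔ N M N≤m) (right⊔ N M N≤n))

    ∼-neg : ∀ {f g} → f ∼ g → (λ n → ℚ.- f n) ∼ (λ n → ℚ.- g n)
    ∼-neg {f} {g} f∼g .close ε ε>0 with close f∼g ε ε>0
    ... | N , h = N , λ m n N≤m N≤n →
      ≡.subst (ℚ._< ε)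
        (≡.trans (≡.sym (ℚₚ.∣-p∣≡∣p∣ _))
                 (≡.cong ∣_∣ (solve 2 (λ a b → :- (a :- b) := :- a :- :- b) ≡.refl (f m) (g n))))
        (h m n N≤m N≤n)

    ∼-bounded : ∀ {f g} → f ∼ g →
      Σ[ B ∈ ℚ ] ℚ.Positive B × ∃[ N ] (∀ m → N ℕ.≤ m → ∣ f m ∣ ℚ.≤ B)
    ∼-bounded {f} {g} f∼g with close f∼g 1ℚ (ℚₚ.positive⁻¹ 1ℚ)
    ... | N , p = ∣ g N ∣ ℚ.+ 1ℚ , pos , N , λ m N≤m →
      ≡.subst (λ t → ∣ t ∣ ℚ.≤ ∣ g N ∣ ℚ.+ 1ℚ)
        (solve 2 (λ a b → b :+ (a :- b) := a) ≡.refl (f m) (g N))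
        (ℚₚ.≤-trans (ℚₚ.∣p+q∣≤∣p∣+∣q∣ (g N) (f m ℚ.- g N))
          (ℚₚ.+-monoʳ-≤ ∣ g N ∣ (ℚₚ.<⇒≤ (p m N N≤m ℕₚ.≤-refl))))
      where
      pos : ℚ.Positive (∣ g N ∣ ℚ.+ 1ℚ)
      pos = ℚₚ.nonNeg+pos⇒pos ∣ g N ∣ {{ℚₚ.∣-∣-nonNeg (g N)}} 1ℚ

    -- Given B > 0 and η > 0, some δ > 0 satisfies ∣a∣ ≤ B → ∣b∣ < δ → ∣a b∣ < η.
    product-bound : ∀ B → ℚ.Positive B → ∀ η → 0ℚ ℚ.< η →
      Σ[ δ ∈ ℚ ] 0ℚ ℚ.< δ × (∀ a b → ∣ a ∣ ℚ.≤ B → ∣ b ∣ ℚ.< δ → ∣ a ℚ.* b ∣ ℚ.< η)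
    product-bound B B>0 η η>0 = δ , δ>0 , bound
      where
      instance
        _ = B>0
        _ = ℚₚ.pos⇒nonZero B
      δ = 1/ B ℚ.* η
      δ>0 : 0ℚ ℚ.< δ
      δ>0 = ℚₚ.positive⁻¹ δ {{ℚₚ.pos*pos⇒pos (1/ B) {{ℚₚ.1/pos⇒pos B}} η {{ℚ.positive η>0}}}}
      B*δ≡η : B ℚ.* δ ≡ η
      B*δ≡η = ≡.trans (≡.sym (ℚₚ.*-assoc B (1/ B) η))
        (≡.trans (≡.cong (ℚ._* η) (ℚₚ.*-inverseʳ B)) (ℚₚ.*-identityˡ η))
      bound : ∀ a b → ∣ a ∣ ℚ.≤ B → ∣ b ∣ ℚ.< δ → ∣ a ℚ.* b ∣ ℚ.< η
      bound a b a≤ b< = ≡.subst₂ ℚ._<_ (≡.sym (ℚₚ.∣p*q∣≡∣p∣*∣q∣ a b)) B*δ≡η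
        (ℚₚ.≤-<-trans (ℚₚ.*-monoʳ-≤-nonNeg ∣ b ∣ {{ℚₚ.∣-∣-nonNeg b}} a≤)
                      (ℚₚ.*-monoʳ-<-pos B b<))

    product-difference : ∀ a b c d → a ℚ.* c ℚ.- b ℚ.* d ≡ a ℚ.* (c ℚ.- d) ℚ.+ d ℚ.* (a ℚ.- b)
    product-difference = solve 4 (λ a b c d → a :* c :- b :* d := a :* (c :- d) :+ d :* (a :- b)) ≡.refl

    ∼-* : ∀ {f f′ g g′} → f ∼ f′ → g ∼ g′ → (λ n → f n ℚ.* g n) ∼ (λ n → f′ n ℚ.* g′ n)
    ∼-* {f} {f′} {g} {g′} f∼f′ g∼g′ .close ε ε>0 =
      let B , B>0 , K , f≤B  = ∼-bounded f∼f′
          C , C>0 , L , g′≤C = ∼-bounded (∼-sym g∼g′)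
          δ , δ>0 , Bδ = product-bound B B>0 (½ ℚ.* ε) (half>0 ε>0)
          η , η>0 , Cη = product-bound C C>0 (½ ℚ.* ε) (half>0 ε>0)
          M , q = close g∼g′ δ δ>0
          N , p = close f∼f′ η η>0
      in (K ℕ.⊔ L) ℕ.⊔ (M ℕ.⊔ N) , λ m n ≤m ≤n →
        let K⊔L≤m = left⊔ (K ℕ.⊔ L) (M ℕ.⊔ N) ≤m
            K⊔L≤n = left⊔ (K ℕ.⊔ L) (M ℕ.⊔ N) ≤n
            M⊔N≤m = right⊔ (K ℕ.⊔ L) (M ℕ.⊔ N) ≤m
            M⊔N≤n = right⊔ (K ℕ.⊔ L) (M ℕ.⊔ N) ≤n
        in add-halves {ε} (f m ℚ.* (g m ℚ.- g′ n)) (g′ n ℚ.* (f m ℚ.- f′ n))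
          (product-difference (f m) (f′ n) (g m) (g′ n))
          (Bδ (f m) (g m ℚ.- g′ n) (f≤B m (left⊔ K L K⊔L≤m))
            (q m n (left⊔ M N M⊔N≤m) (left⊔ M N M⊔N≤n)))
          (Cη (g′ n) (f m ℚ.- f′ n) (g′≤C n (right⊔ K L K⊔L≤n))
            (p m n (right⊔ M N M⊔N≤m) (right⊔ M N M⊔N≤n)))

    ∼-const : ∀ q → (λ _ → q) ∼ (λ _ → q)
    ∼-const q .close ε ε>0 = 0 , λ _ _ _ _ →
      ≡.subst (λ t → ∣ t ∣ ℚ.< ε) (≡.sym (ℚₚ.+-inverseʳ q)) ε>0

  infixl 6 _+ᴿ_
  infixl 7 _*ᴿ_

  _+ᴿ_ _*ᴿ_ : Op₂ ℝ
  x +ᴿ y = real (λ n → seq x n ℚ.+ seq y n) (∼-+ (cauchy x) (cauchy y))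
  x *ᴿ y = real (λ n → seq x n ℚ.* seq y n) (∼-* (cauchy x) (cauchy y))

  -ᴿ_ : Op₁ ℝ
  -ᴿ x = real (λ n → ℚ.- seq x n) (∼-neg (cauchy x))

  fromℚ : ℚ → ℝ
  fromℚ q = real (λ _ → q) (∼-const q)

  private
    pointwise : ∀ {x y} → (∀ n → seq x n ≡ seq y n) → x ≈ᴿ y
    pointwise {x} x≗y = eqᴿ (∼-≗ (cauchy x) x≗y)

  abstract
    ℝ-isCommutativeRing : IsCommutativeRing _≈ᴿ_ _+ᴿ_ _*ᴿ_ -ᴿ_ (fromℚ 0ℚ) (fromℚ 1ℚ)
    ℝ-isCommutativeRing = mkIsCommutativeRing
      (record
        { refl  = λ {x} → eqᴿ (cauchy x)
        ; sym   = λ x≈y → eqᴿ (∼-sym (seq∼ x≈y))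
        ; trans = λ x≈y y≈z → eqᴿ (∼-trans (seq∼ x≈y) (seq∼ y≈z))
        })
      (λ x≈ y≈ → eqᴿ (∼-+ (seq∼ x≈) (seq∼ y≈)))
      (λ x y z → pointwise λ n → ℚₚ.+-assoc (seq x n) (seq y n) (seq z n))
      (λ x y → pointwise λ n → ℚₚ.+-comm (seq x n) (seq y n))
      (λ x → pointwise λ n → ℚₚ.+-identityˡ (seq x n))
      (λ x≈ → eqᴿ (∼-neg (seq∼ x≈)))
      (λ x → pointwise λ n → ℚₚ.+-inverseˡ (seq x n))
      (λ x≈ y≈ → eqᴿ (∼-* (seq∼ x≈) (seq∼ y≈)))
      (λ x y z → pointwise λ n → ℚₚ.*-assoc (seq x n) (seq y n) (seq z n))
      (λ x y → pointwise λ n → ℚₚ.*-comm (seq x n) (seq y n))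
      (λ x → pointwise λ n → ℚₚ.*-identityˡ (seq x n))
      (λ x y z → pointwise λ n → ℚₚ.*-distribʳ-+ (seq x n) (seq y n) (seq z n))

  ℝ-commutativeRing : CommutativeRing 0ℓ 0ℓ
  ℝ-commutativeRing = record { isCommutativeRing = ℝ-isCommutativeRing }

  record ℂ : Set where
    constructor _+i_
    field
      re im : ℝ

  open ℂ

  infix 4 _≈ᶜ_
  record _≈ᶜ_ (w z : ℂ) : Set where
    constructor eqᶜ
    field
      re≈ : re w ≈ᴿ re z
      im≈ : im w ≈ᴿ im z

  infixl 6 _+ᶜ_
  infixl 7 _*ᶜ_

  _+ᶜ_ _*ᶜ_ : Op₂ ℂ
  (a +i b) +ᶜ (c +i d) = (a +ᴿ c) +i (b +ᴿ d)
  (a +i b) *ᶜ (c +i d) = ((a *ᴿ c) +ᴿ (-ᴿ (b *ᴿ d))) +i ((a *ᴿ d) +ᴿ (b *ᴿ c))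

  -ᶜ_ : Op₁ ℂ
  -ᶜ (a +i b) = (-ᴿ a) +i (-ᴿ b)

  private
    *-assoc-re : ∀ a b c d e f →
      (a ℚ.* c ℚ.+ ℚ.- (b ℚ.* d)) ℚ.* e ℚ.+ ℚ.- ((a ℚ.* d ℚ.+ b ℚ.* c) ℚ.* f) ≡
      a ℚ.* (c ℚ.* e ℚ.+ ℚ.- (d ℚ.* f)) ℚ.+ ℚ.- (b ℚ.* (c ℚ.* f ℚ.+ d ℚ.* e))
    *-assoc-re = solve 6 (λ a b c d e f →
      (a :* c :+ :- (b :* d)) :* e :+ :- ((a :* d :+ b :* c) :* f) :=
      a :* (c :* e :+ :- (d :* f)) :+ :- (b :* (c :* f :+ d :* e))) ≡.refl

    *-assoc-im : ∀ a b c d e f →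
      (a ℚ.* c ℚ.+ ℚ.- (b ℚ.* d)) ℚ.* f ℚ.+ (a ℚ.* d ℚ.+ b ℚ.* c) ℚ.* e ≡
      a ℚ.* (c ℚ.* f ℚ.+ d ℚ.* e) ℚ.+ b ℚ.* (c ℚ.* e ℚ.+ ℚ.- (d ℚ.* f))
    *-assoc-im = solve 6 (λ a b c d e f →
      (a :* c :+ :- (b :* d)) :* f :+ (a :* d :+ b :* c) :* e :=
      a :* (c :* f :+ d :* e) :+ b :* (c :* e :+ :- (d :* f))) ≡.refl

    *-identityˡ-re : ∀ a b → 1ℚ ℚ.* a ℚ.+ ℚ.- (0ℚ ℚ.* b) ≡ a
    *-identityˡ-re = solve 2 (λ a b → con 1ℚ :* a :+ :- (con 0ℚ :* b) := a) ≡.refl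

    *-identityˡ-im : ∀ a b → 1ℚ ℚ.* b ℚ.+ 0ℚ ℚ.* a ≡ b
    *-identityˡ-im = solve 2 (λ a b → con 1ℚ :* b :+ con 0ℚ :* a := b) ≡.refl

    distribʳ-re : ∀ a b c d e f →
      (c ℚ.+ e) ℚ.* a ℚ.+ ℚ.- ((d ℚ.+ f) ℚ.* b) ≡
      (c ℚ.* a ℚ.+ ℚ.- (d ℚ.* b)) ℚ.+ (e ℚ.* a ℚ.+ ℚ.- (f ℚ.* b))
    distribʳ-re = solve 6 (λ a b c d e f →
      (c :+ e) :* a :+ :- ((d :+ f) :* b) :=
      (c :* a :+ :- (d :* b)) :+ (e :* a :+ :- (f :* b))) ≡.refl

    distribʳ-im : ∀ a b c d e f →
      (c ℚ.+ e) ℚ.* b ℚ.+ (d ℚ.+ f) ℚ.* a ≡ (c ℚ.* b ℚ.+ d ℚ.* a) ℚ.+ (e ℚ.* b ℚ.+ f ℚ.* a)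
    distribʳ-im = solve 6 (λ a b c d e f →
      (c :+ e) :* b :+ (d :+ f) :* a :=
      (c :* b :+ d :* a) :+ (e :* b :+ f :* a)) ≡.refl

  abstract
    ℂ-isCommutativeRing : IsCommutativeRing _≈ᶜ_ _+ᶜ_ _*ᶜ_ -ᶜ_ (fromℚ 0ℚ +i fromℚ 0ℚ) (fromℚ 1ℚ +i fromℚ 0ℚ)
    ℂ-isCommutativeRing = mkIsCommutativeRing
      (record
        { refl  = eqᶜ R.refl R.refl
        ; sym   = λ { (eqᶜ p q) → eqᶜ (R.sym p) (R.sym q) }
        ; trans = λ { (eqᶜ p q) (eqᶜ p′ q′) → eqᶜ (R.trans p p′) (R.trans q q′) }
        })
      (λ { (eqᶜ p q) (eqᶜ p′ q′) → eqᶜ (R.+-cong p p′) (R.+-cong q q′) })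
      (λ { (a +i b) (c +i d) (e +i f) → eqᶜ (R.+-assoc a c e) (R.+-assoc b d f) })
      (λ { (a +i b) (c +i d) → eqᶜ (R.+-comm a c) (R.+-comm b d) })
      (λ { (a +i b) → eqᶜ (R.+-identityˡ a) (R.+-identityˡ b) })
      (λ { (eqᶜ p q) → eqᶜ (R.-‿cong p) (R.-‿cong q) })
      (λ { (a +i b) → eqᶜ (R.-‿inverseˡ a) (R.-‿inverseˡ b) })
      (λ { (eqᶜ p q) (eqᶜ p′ q′) →
           eqᶜ (R.+-cong (R.*-cong p p′) (R.-‿cong (R.*-cong q q′)))
               (R.+-cong (R.*-cong p q′) (R.*-cong q p′)) })
      (λ { (a +i b) (c +i d) (e +i f) → eqᶜ
        (pointwise λ n → *-assoc-re (seq a n) (seq b n) (seq c n) (seq d n) (seq e n) (seq f n))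
        (pointwise λ n → *-assoc-im (seq a n) (seq b n) (seq c n) (seq d n) (seq e n) (seq f n)) })
      (λ { (a +i b) (c +i d) → eqᶜ
        (R.+-cong (R.*-comm a c) (R.-‿cong (R.*-comm b d)))
        (R.trans (R.+-comm (a *ᴿ d) (b *ᴿ c)) (R.+-cong (R.*-comm b c) (R.*-comm a d))) })
      (λ { (a +i b) → eqᶜ
        (pointwise λ n → *-identityˡ-re (seq a n) (seq b n))
        (pointwise λ n → *-identityˡ-im (seq a n) (seq b n)) })
      (λ { (a +i b) (c +i d) (e +i f) → eqᶜ
        (pointwise λ n → distribʳ-re (seq a n) (seq b n) (seq c n) (seq d n) (seq e n) (seq f n))
        (pointwise λ n → distribʳ-im (seq a n) (seq b n) (seq c n) (seq d n) (seq e n) (seq f n)) })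
      where module R = CommutativeRing ℝ-commutativeRing

  ℂ-commutativeRing : CommutativeRing 0ℓ 0ℓ
  ℂ-commutativeRing = record { isCommutativeRing = ℂ-isCommutativeRing }

open Complex public using (ℝ; ℂ; ℝ-commutativeRing; ℂ-commutativeRing)

module Rearrange (R : CommutativeRing c ℓ) where

  open CommutativeRing R using (Carrier; _≈_; _+_; _*_; refl; commutativeSemiring)
  private module Solver = SemiringSolver commutativeSemiring
  open Solver

  swap-+ : ∀ a b c → a + (b + c) ≈ b + (a + c)
  swap-+ = solve 3 (λ a b c → a :+ (b :+ c) := b :+ (a :+ c)) refl

  distrib-+ : ∀ a b c d e → (a + b) * c + (d + e) ≈ (a * c + d) + (b * c + e)
  distrib-+ = solve 5 (λ a b c d e → (a :+ b) :* c :+ (d :+ e) := (a :* c :+ d) :+ (b :* c :+ e)) refl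

  factor-+ : ∀ a b c d e → a * b * c + (a * d + e) ≈ a * (b * c + d) + e
  factor-+ = solve 5 (λ a b c d e → a :* b :* c :+ (a :* d :+ e) := a :* (b :* c :+ d) :+ e) refl

  rotate : ∀ x y z → x * (y * z) ≈ (y * x) * z
  rotate = solve 3 (λ x y z → x :* (y :* z) := (y :* x) :* z) refl

  swapʳ : ∀ x y z → (x * y) * z ≈ (x * z) * y
  swapʳ = solve 3 (λ x y z → (x :* y) :* z := (x :* z) :* y) refl

  interchange : ∀ w x y z → (w * x) * (y * z) ≈ (w * y) * (x * z)
  interchange = solve 4 (λ w x y z → (w :* x) :* (y :* z) := (w :* y) :* (x :* z)) refl

  fraction-+ : ∀ a b c d b′ d′ →
    (a * d + c * b) * (b′ * d′) ≈ (a * b′) * (d * d′) + (c * d′) * (b * b′)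
  fraction-+ = solve 6 (λ a b c d b′ d′ → (a :* d :+ c :* b) :* (b′ :* d′) :=
    (a :* b′) :* (d :* d′) :+ (c :* d′) :* (b :* b′)) refl

  fraction-+′ : ∀ a b c d b′ d′ →
    (a * b) * (d * d′) + (c * d) * (b * b′) ≈ (a * d′ + c * b′) * (b * d)
  fraction-+′ = solve 6 (λ a b c d b′ d′ → (a :* b) :* (d :* d′) :+ (c :* d) :* (b :* b′) :=
    (a :* d′ :+ c :* b′) :* (b :* d)) refl

  fraction-+-assoc : ∀ a b c d e f →
    ((a * d + c * b) * f + e * (b * d)) * (b * (d * f)) ≈
    (a * (d * f) + (c * f + e * d) * b) * ((b * d) * f)
  fraction-+-assoc = solve 6 (λ a b c d e f →
    ((a :* d :+ c :* b) :* f :+ e :* (b :* d)) :* (b :* (d :* f)) :=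
    (a :* (d :* f) :+ (c :* f :+ e :* d) :* b) :* ((b :* d) :* f)) refl

  fraction-+-comm : ∀ a b c d → (a * d + c * b) * (d * b) ≈ (c * b + a * d) * (b * d)
  fraction-+-comm = solve 4 (λ a b c d →
    (a :* d :+ c :* b) :* (d :* b) := (c :* b :+ a :* d) :* (b :* d)) refl

  fraction-distribʳ : ∀ a b c d e f →
    ((c * f + e * d) * a) * ((d * b) * (f * b)) ≈
    ((c * a) * (f * b) + (e * a) * (d * b)) * ((d * f) * b)
  fraction-distribʳ = solve 6 (λ a b c d e f →
    ((c :* f :+ e :* d) :* a) :* ((d :* b) :* (f :* b)) :=
    ((c :* a) :* (f :* b) :+ (e :* a) :* (d :* b)) :* ((d :* f) :* b)) refl

module PowerSeries (R : CommutativeRing c ℓ) where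

  open CommutativeRing R hiding (zero; isCommutativeRing)
  open MonoidSum +-monoid using (sum⁺-syntax)
  open SetoidReasoning setoid
  open RingProperties ring using (-0#≈0#)

  Series : Set c
  Series = ℕ → Carrier

  infix 4 _≈ˢ_
  record _≈ˢ_ (f g : Series) : Set ℓ where
    constructor eqˢ
    field coeff≈ : ∀ n → f n ≈ g n

  open _≈ˢ_ public

  0ˢ 1ˢ t : Series
  0ˢ n = 0#
  1ˢ zero    = 1#
  1ˢ (suc _) = 0#
  t zero          = 0#
  t (suc zero)    = 1#
  t (suc (suc _)) = 0#

  constant : Carrier → Series
  constant a zero    = a
  constant a (suc _) = 0#

  infixl 6 _+ˢ_
  infixl 7 _*ˢ_

  _+ˢ_ _*ˢ_ : Op₂ Series
  (f +ˢ g) n = f n + g n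
  (f *ˢ g) n = ∑[ i ≤ n ] (f (toℕ i) * g (n ∸ toℕ i))

  -ˢ_ : Op₁ Series
  (-ˢ f) n = - f n

  tail : Series → Series
  tail f n = f (suc n)

  *ˢ-zero : ∀ f g → (f *ˢ g) 0 ≈ f 0 * g 0
  *ˢ-zero f g = +-identityʳ _

  *ˢ-cong′ : ∀ {f f′ g g′} → (∀ n → f n ≈ f′ n) → (∀ n → g n ≈ g′ n) →
             ∀ n → (f *ˢ g) n ≈ (f′ *ˢ g′) n
  *ˢ-cong′ f≈ g≈ zero    = +-congʳ (*-cong (f≈ 0) (g≈ 0))
  *ˢ-cong′ f≈ g≈ (suc n) =
    +-cong (*-cong (f≈ 0) (g≈ (suc n))) (*ˢ-cong′ (f≈ ∘ suc) g≈ n)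

  *ˢ-zeroˡ : ∀ {f} g → (∀ n → f n ≈ 0#) → ∀ n → (f *ˢ g) n ≈ 0#
  *ˢ-zeroˡ g f≈0 zero    = trans (+-identityʳ _) (trans (*-congʳ (f≈0 0)) (zeroˡ _))
  *ˢ-zeroˡ g f≈0 (suc n) = trans
    (+-cong (trans (*-congʳ (f≈0 0)) (zeroˡ _)) (*ˢ-zeroˡ g (f≈0 ∘ suc) n)) (+-identityˡ _)

  *ˢ-sucʳ : ∀ f g n → (f *ˢ g) (suc n) ≈ f (suc n) * g 0 + (f *ˢ tail g) n
  *ˢ-sucʳ f g zero    = begin
    f 0 * g 1 + (f 1 * g 0 + 0#)  ≈⟨ +-comm _ _ ⟩
    f 1 * g 0 + 0# + f 0 * g 1    ≈⟨ +-cong (+-identityʳ _) (sym (+-identityʳ _)) ⟩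
    f 1 * g 0 + (f 0 * g 1 + 0#)  ∎
  *ˢ-sucʳ f g (suc n) = begin
    f 0 * g (2 ℕ.+ n) + (tail f *ˢ g) (suc n)
      ≈⟨ +-congˡ (*ˢ-sucʳ (tail f) g n) ⟩
    f 0 * g (2 ℕ.+ n) + (f (2 ℕ.+ n) * g 0 + (tail f *ˢ tail g) n)
      ≈⟨ Rearrange.swap-+ R _ _ _ ⟩
    f (2 ℕ.+ n) * g 0 + (f 0 * g (2 ℕ.+ n) + (tail f *ˢ tail g) n) ∎

  *ˢ-comm : ∀ f g n → (f *ˢ g) n ≈ (g *ˢ f) n
  *ˢ-comm f g zero    = +-congʳ (*-comm _ _)
  *ˢ-comm f g (suc n) = begin
    f 0 * g (suc n) + (tail f *ˢ g) n  ≈⟨ +-cong (*-comm _ _) (*ˢ-comm (tail f) g n) ⟩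
    g (suc n) * f 0 + (g *ˢ tail f) n  ≈⟨ *ˢ-sucʳ g f n ⟨
    (g *ˢ f) (suc n) ∎

  *ˢ-distribʳ : ∀ h f g n → ((f +ˢ g) *ˢ h) n ≈ (f *ˢ h) n + (g *ˢ h) n
  *ˢ-distribʳ h f g zero    = begin
    (f 0 + g 0) * h 0 + 0#                 ≈⟨ +-identityʳ _ ⟩
    (f 0 + g 0) * h 0                      ≈⟨ distribʳ _ _ _ ⟩
    f 0 * h 0 + g 0 * h 0                  ≈⟨ +-cong (*ˢ-zero f h) (*ˢ-zero g h) ⟨
    (f 0 * h 0 + 0#) + (g 0 * h 0 + 0#)    ∎
  *ˢ-distribʳ h f g (suc n) = begin
    (f 0 + g 0) * h (suc n) + ((tail f +ˢ tail g) *ˢ h) n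
      ≈⟨ +-congˡ (*ˢ-distribʳ h (tail f) (tail g) n) ⟩
    (f 0 + g 0) * h (suc n) + ((tail f *ˢ h) n + (tail g *ˢ h) n)
      ≈⟨ Rearrange.distrib-+ R _ _ _ _ _ ⟩
    (f 0 * h (suc n) + (tail f *ˢ h) n) + (g 0 * h (suc n) + (tail g *ˢ h) n) ∎

  scale-*ˢ : ∀ a f g n → ((λ k → a * f k) *ˢ g) n ≈ a * (f *ˢ g) n
  scale-*ˢ a f g zero    = begin
    a * f 0 * g 0 + 0#    ≈⟨ +-identityʳ _ ⟩
    a * f 0 * g 0         ≈⟨ *-assoc _ _ _ ⟩
    a * (f 0 * g 0)       ≈⟨ *-congˡ (*ˢ-zero f g) ⟨
    a * (f 0 * g 0 + 0#)  ∎
  scale-*ˢ a f g (suc n) = begin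
    a * f 0 * g (suc n) + ((λ k → a * tail f k) *ˢ g) n
      ≈⟨ +-cong (*-assoc _ _ _) (scale-*ˢ a (tail f) g n) ⟩
    a * (f 0 * g (suc n)) + a * (tail f *ˢ g) n
      ≈⟨ distribˡ _ _ _ ⟨
    a * (f 0 * g (suc n) + (tail f *ˢ g) n) ∎

  *ˢ-assoc : ∀ f g h n → ((f *ˢ g) *ˢ h) n ≈ (f *ˢ (g *ˢ h)) n
  *ˢ-assoc f g h zero    = +-congʳ (begin
    (f 0 * g 0 + 0#) * h 0    ≈⟨ *-congʳ (+-identityʳ _) ⟩
    f 0 * g 0 * h 0           ≈⟨ *-assoc _ _ _ ⟩
    f 0 * (g 0 * h 0)         ≈⟨ *-congˡ (*ˢ-zero g h) ⟨
    f 0 * (g 0 * h 0 + 0#)    ∎)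
  *ˢ-assoc f g h (suc n) = begin
    (f 0 * g 0 + 0#) * h (suc n) + (((λ k → f 0 * tail g k) +ˢ (tail f *ˢ g)) *ˢ h) n
      ≈⟨ +-cong (*-congʳ (+-identityʳ _)) (*ˢ-distribʳ h (λ k → f 0 * tail g k) (tail f *ˢ g) n) ⟩
    f 0 * g 0 * h (suc n) + (((λ k → f 0 * tail g k) *ˢ h) n + ((tail f *ˢ g) *ˢ h) n)
      ≈⟨ +-congˡ (+-cong (scale-*ˢ (f 0) (tail g) h n) (*ˢ-assoc (tail f) g h n)) ⟩
    f 0 * g 0 * h (suc n) + (f 0 * (tail g *ˢ h) n + (tail f *ˢ (g *ˢ h)) n)
      ≈⟨ Rearrange.factor-+ R _ _ _ _ _ ⟩
    f 0 * (g 0 * h (suc n) + (tail g *ˢ h) n) + (tail f *ˢ (g *ˢ h)) n ∎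

  *ˢ-identityˡ : ∀ f n → (1ˢ *ˢ f) n ≈ f n
  *ˢ-identityˡ f zero    = trans (+-identityʳ _) (*-identityˡ _)
  *ˢ-identityˡ f (suc n) = trans
    (+-cong (*-identityˡ _) (*ˢ-zeroˡ f (λ _ → refl) n)) (+-identityʳ _)

  abstract
    isCommutativeRing : IsCommutativeRing _≈ˢ_ _+ˢ_ _*ˢ_ -ˢ_ 0ˢ 1ˢ
    isCommutativeRing = mkIsCommutativeRing
      (record
        { refl  = eqˢ λ _ → refl
        ; sym   = λ p → eqˢ λ n → sym (coeff≈ p n)
        ; trans = λ p q → eqˢ λ n → trans (coeff≈ p n) (coeff≈ q n)
        })
      (λ p q → eqˢ λ n → +-cong (coeff≈ p n) (coeff≈ q n))
      (λ _ _ _ → eqˢ λ _ → +-assoc _ _ _)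
      (λ _ _ → eqˢ λ _ → +-comm _ _)
      (λ _ → eqˢ λ _ → +-identityˡ _)
      (λ p → eqˢ λ n → -‿cong (coeff≈ p n))
      (λ _ → eqˢ λ _ → -‿inverseˡ _)
      (λ p q → eqˢ (*ˢ-cong′ (coeff≈ p) (coeff≈ q)))
      (λ f g h → eqˢ (*ˢ-assoc f g h))
      (λ f g → eqˢ (*ˢ-comm f g))
      (λ f → eqˢ (*ˢ-identityˡ f))
      (λ h f g → eqˢ (*ˢ-distribʳ h f g))

  commutativeRing : CommutativeRing c ℓ
  commutativeRing = record { isCommutativeRing = isCommutativeRing }

  VanishesFrom : ℕ → Series → Set ℓ
  VanishesFrom N f = ∀ n → N ℕ.≤ n → f n ≈ 0#

  abstract
    vanishes-+ : ∀ {N M f g} → VanishesFrom N f → VanishesFrom M g → VanishesFrom (N ℕ.⊔ M) (f +ˢ g)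
    vanishes-+ {N} {M} f0 g0 n ≤n = trans (+-cong (f0 n (left⊔ N M ≤n)) (g0 n (right⊔ N M ≤n))) (+-identityˡ _)

    vanishes-neg : ∀ {N f} → VanishesFrom N f → VanishesFrom N (-ˢ f)
    vanishes-neg f0 n ≤n = trans (-‿cong (f0 n ≤n)) -0#≈0#

    vanishes-* : ∀ {N M f g} → VanishesFrom N f → VanishesFrom M g → VanishesFrom (N ℕ.+ M) (f *ˢ g)
    vanishes-* {zero} {g = g} f0 g0 n ≤n = *ˢ-zeroˡ g (λ k → f0 k z≤n) n
    vanishes-* {suc N} {M} {f} {g} f0 g0 (suc n) (s≤s ≤n) = trans
      (+-cong (trans (*-congˡ (g0 (suc n) (ℕₚ.m≤n⇒m≤1+n (ℕₚ.≤-trans (ℕₚ.m≤n+m M N) ≤n)))) (zeroʳ _))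
              (vanishes-* {N} {M} {tail f} (λ k ≤k → f0 (suc k) (s≤s ≤k)) g0 n ≤n))
      (+-identityˡ _)

module Polynomials (R : CommutativeRing c ℓ) where

  open CommutativeRing R using (Carrier; 0#; 1#; refl)
  private
    module S = PowerSeries R
    module Sᴿ = CommutativeRing (PowerSeries.commutativeRing R)

  record Polynomial : Set (c ⊔ ℓ) where
    constructor poly
    field
      coeff    : ℕ → Carrier
      bound    : ℕ
      vanishes : S.VanishesFrom bound coeff

  open Polynomial public

  infix 4 _≈ᴾ_
  record _≈ᴾ_ (p q : Polynomial) : Set ℓ where
    constructor eqᴾ
    field coeffs≈ : S._≈ˢ_ (coeff p) (coeff q)

  open _≈ᴾ_ public

  constant : Carrier → Polynomial
  constant a = poly (S.constant a) 1 λ { (suc _) _ → refl }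

  indeterminate : Polynomial
  indeterminate = poly S.t 2 λ { (suc (suc _)) _ → refl ; (suc zero) (s≤s ()) }

  infixl 6 _+ᴾ_
  infixl 7 _*ᴾ_

  _+ᴾ_ _*ᴾ_ : Op₂ Polynomial
  p +ᴾ q = poly (coeff p S.+ˢ coeff q) (bound p ℕ.⊔ bound q)
    (S.vanishes-+ {f = coeff p} {coeff q} (vanishes p) (vanishes q))
  p *ᴾ q = poly (coeff p S.*ˢ coeff q) (bound p ℕ.+ bound q)
    (S.vanishes-* {f = coeff p} {coeff q} (vanishes p) (vanishes q))

  -ᴾ_ : Op₁ Polynomial
  -ᴾ p = poly (S.-ˢ coeff p) (bound p) (S.vanishes-neg {f = coeff p} (vanishes p))

  0ᴾ 1ᴾ : Polynomial
  0ᴾ = poly S.0ˢ 0 λ _ _ → refl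
  1ᴾ = poly S.1ˢ 1 λ { (suc _) _ → refl }

  abstract
    isCommutativeRing : IsCommutativeRing _≈ᴾ_ _+ᴾ_ _*ᴾ_ -ᴾ_ 0ᴾ 1ᴾ
    isCommutativeRing = mkIsCommutativeRing
      (record
        { refl  = eqᴾ Sᴿ.refl
        ; sym   = λ p → eqᴾ (Sᴿ.sym (coeffs≈ p))
        ; trans = λ p q → eqᴾ (Sᴿ.trans (coeffs≈ p) (coeffs≈ q))
        })
      (λ p q → eqᴾ (Sᴿ.+-cong (coeffs≈ p) (coeffs≈ q)))
      (λ _ _ _ → eqᴾ (Sᴿ.+-assoc _ _ _))
      (λ _ _ → eqᴾ (Sᴿ.+-comm _ _))
      (λ _ → eqᴾ (Sᴿ.+-identityˡ _))
      (λ p → eqᴾ (Sᴿ.-‿cong (coeffs≈ p)))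
      (λ _ → eqᴾ (Sᴿ.-‿inverseˡ _))
      (λ p q → eqᴾ (Sᴿ.*-cong (coeffs≈ p) (coeffs≈ q)))
      (λ p q r → eqᴾ (Sᴿ.*-assoc (coeff p) (coeff q) (coeff r)))
      (λ p q → eqᴾ (Sᴿ.*-comm (coeff p) (coeff q)))
      (λ p → eqᴾ (Sᴿ.*-identityˡ (coeff p)))
      (λ p q r → eqᴾ (Sᴿ.distribʳ (coeff p) (coeff q) (coeff r)))

  commutativeRing : CommutativeRing (c ⊔ ℓ) ℓ
  commutativeRing = record { isCommutativeRing = isCommutativeRing }

module Regularity (R : CommutativeRing c ℓ) where

  open CommutativeRing R hiding (zero; isCommutativeRing)
  open Exp semiring using (_^_)
  open MonoidSum *-monoid using () renaming (sum to product)

  record Regular (b : Carrier) : Set (c ⊔ ℓ) where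
    constructor regular
    no-eta-equality
    field
      cancel-0 : ∀ a → b * a ≈ 0# → a ≈ 0#

  open Regular public

  1-regular : Regular 1#
  1-regular .cancel-0 a 1a≈0 = trans (sym (*-identityˡ a)) 1a≈0

  *-regular : ∀ {a b} → Regular a → Regular b → Regular (a * b)
  *-regular ra rb .cancel-0 d abd≈0 = cancel-0 rb d (cancel-0 ra _ (trans (sym (*-assoc _ _ _)) abd≈0))

  ≈-regular : ∀ {a b} → a ≈ b → Regular a → Regular b
  ≈-regular a≈b ra .cancel-0 d bd≈0 = cancel-0 ra d (trans (*-congʳ a≈b) bd≈0)

  product-regular : ∀ {n} (v : Vector Carrier n) → (∀ i → Regular (v i)) → Regular (product v)
  product-regular {zero}  v rv = 1-regular
  product-regular {suc n} v rv = *-regular (rv zero) (product-regular (v ∘ suc) (rv ∘ suc))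

  ^-regular : ∀ {a} → Regular a → ∀ n → Regular (a ^ n)
  ^-regular ra zero    = 1-regular
  ^-regular ra (suc n) = *-regular ra (^-regular ra n)

  regular⇒cancel : ∀ {b} → Regular b → ∀ {x y} → b * x ≈ b * y → x ≈ y
  regular⇒cancel {b} rb {x} {y} bx≈by = x∙y⁻¹≈ε⇒x≈y x y (cancel-0 rb (x - y) (begin
    b * (x - y)        ≈⟨ x[y-z]≈xy-xz b x y ⟩
    b * x - b * y      ≈⟨ x≈y⇒x∙y⁻¹≈ε bx≈by ⟩
    0#                 ∎))
    where
    open SetoidReasoning setoid
    open RingProperties ring using (x[y-z]≈xy-xz)
    open import Algebra.Properties.Group +-group using (x∙y⁻¹≈ε⇒x≈y; x≈y⇒x∙y⁻¹≈ε)

-- In an integral domain the regular elements are exactly the nonzero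
-- ones, and this is the field of fractions.  Regularity is used because
-- it needs no decision procedure for equality with 0.
module Fractions (R : CommutativeRing c ℓ) where

  open CommutativeRing R hiding (zero; isCommutativeRing)
  open Regularity R
  open SetoidReasoning setoid

  record Fraction : Set (c ⊔ ℓ) where
    constructor _/_[_]
    field
      num         : Carrier
      den         : Carrier
      den-regular : Regular den

  open Fraction public

  infix 4 _≈ᶠ_
  record _≈ᶠ_ (p q : Fraction) : Set ℓ where
    constructor eqᶠ
    field cross : num p * den q ≈ num q * den p

  open _≈ᶠ_ public

  fromRing : Carrier → Fraction
  fromRing a = a / 1# [ 1-regular ]

  infixl 6 _+ᶠ_
  infixl 7 _*ᶠ_

  -- Opaque so that conversion checking stays structural when fraction
  -- and series rings are nested.
  opaque
    _+ᶠ_ _*ᶠ_ : Op₂ Fraction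
    (a / b [ rb ]) +ᶠ (c / d [ rd ]) = (a * d + c * b) / (b * d) [ *-regular rb rd ]
    (a / b [ rb ]) *ᶠ (c / d [ rd ]) = (a * c) / (b * d) [ *-regular rb rd ]

    -ᶠ_ : Op₁ Fraction
    -ᶠ (a / b [ rb ]) = (- a) / b [ rb ]

  opaque
    unfolding _+ᶠ_ _*ᶠ_ -ᶠ_

    isCommutativeRing : IsCommutativeRing _≈ᶠ_ _+ᶠ_ _*ᶠ_ -ᶠ_ (fromRing 0#) (fromRing 1#)
    isCommutativeRing = mkIsCommutativeRing
      (record
        { refl  = eqᶠ refl
        ; sym   = λ p → eqᶠ (sym (cross p))
        ; trans = λ { {a / b [ _ ]} {c / d [ rd ]} {e / f [ _ ]} (eqᶠ p) (eqᶠ q) →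
            eqᶠ (regular⇒cancel rd (begin
              d * (a * f)  ≈⟨ Rearrange.rotate R d a f ⟩
              (a * d) * f  ≈⟨ *-congʳ p ⟩
              (c * b) * f  ≈⟨ Rearrange.swapʳ R c b f ⟩
              (c * f) * b  ≈⟨ *-congʳ q ⟩
              (e * d) * b  ≈⟨ sym (Rearrange.rotate R d e b) ⟩
              d * (e * b)  ∎)) }
        })
      (λ { {a / b [ _ ]} {a′ / b′ [ _ ]} {c / d [ _ ]} {c′ / d′ [ _ ]} (eqᶠ p) (eqᶠ q) → eqᶠ (begin
        (a * d + c * b) * (b′ * d′)
          ≈⟨ Rearrange.fraction-+ R a b c d b′ d′ ⟩
        (a * b′) * (d * d′) + (c * d′) * (b * b′)
          ≈⟨ +-cong (*-congʳ p) (*-congʳ q) ⟩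
        (a′ * b) * (d * d′) + (c′ * d) * (b * b′)
          ≈⟨ Rearrange.fraction-+′ R a′ b c′ d b′ d′ ⟩
        (a′ * d′ + c′ * b′) * (b * d) ∎) })
      (λ { (a / b [ _ ]) (c / d [ _ ]) (e / f [ _ ]) → eqᶠ
        (Rearrange.fraction-+-assoc R a b c d e f) })
      (λ { (a / b [ _ ]) (c / d [ _ ]) → eqᶠ
        (Rearrange.fraction-+-comm R a b c d) })
      (λ { (a / b [ _ ]) → eqᶠ
        (*-cong
          (trans (+-cong (zeroˡ b) (*-identityʳ a)) (+-identityˡ a)) (sym (*-identityˡ b))) })
      (λ { {a / b [ _ ]} {c / d [ _ ]} (eqᶠ p) → eqᶠ (begin
        - a * d    ≈⟨ -‿distribˡ-* a d ⟨
        - (a * d)  ≈⟨ -‿cong p ⟩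
        - (c * b)  ≈⟨ -‿distribˡ-* c b ⟩
        - c * b    ∎) })
      (λ { (a / b [ _ ]) → eqᶠ (begin
        (- a * b + a * b) * 1#  ≈⟨ *-identityʳ _ ⟩
        - a * b + a * b         ≈⟨ distribʳ b (- a) a ⟨
        (- a + a) * b           ≈⟨ *-congʳ (-‿inverseˡ a) ⟩
        0# * b                  ≈⟨ zeroˡ b ⟩
        0#                      ≈⟨ zeroˡ (b * b) ⟨
        0# * (b * b)            ∎) })
      (λ { {a / b [ _ ]} {a′ / b′ [ _ ]} {c / d [ _ ]} {c′ / d′ [ _ ]} (eqᶠ p) (eqᶠ q) → eqᶠ (begin
        (a * c) * (b′ * d′)  ≈⟨ Rearrange.interchange R a c b′ d′ ⟩
        (a * b′) * (c * d′)  ≈⟨ *-cong p q ⟩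
        (a′ * b) * (c′ * d)  ≈⟨ Rearrange.interchange R a′ b c′ d ⟩
        (a′ * c′) * (b * d)  ∎) })
      (λ { (a / b [ _ ]) (c / d [ _ ]) (e / f [ _ ]) → eqᶠ
        (*-cong (*-assoc a c e) (sym (*-assoc b d f))) })
      (λ { (a / b [ _ ]) (c / d [ _ ]) → eqᶠ (*-cong (*-comm a c) (*-comm d b)) })
      (λ { (a / b [ _ ]) → eqᶠ (*-cong (*-identityˡ a) (sym (*-identityˡ b))) })
      (λ { (a / b [ _ ]) (c / d [ _ ]) (e / f [ _ ]) → eqᶠ
        (Rearrange.fraction-distribʳ R a b c d e f) })
      where
      open RingProperties ring using (-‿distribˡ-*)

  commutativeRing : CommutativeRing (c ⊔ ℓ) ℓ
  commutativeRing = record { isCommutativeRing = isCommutativeRing }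

module SeriesRegularity (R : CommutativeRing c ℓ) where

  open CommutativeRing R hiding (zero)
  open PowerSeries R using
    (_*ˢ_; 1ˢ; t; tail; eqˢ; coeff≈; *ˢ-sucʳ; *ˢ-cong′; *ˢ-identityˡ)
  open Polynomials R using (Polynomial; coeff; indeterminate; eqᴾ; coeffs≈)
  open Regularity using (Regular; cancel-0)

  private
    head-regular′ : ∀ f → Regular R (f 0) → ∀ g → (∀ n → (f *ˢ g) n ≈ 0#) → ∀ n → g n ≈ 0#
    head-regular′ f rf g fg≈0 zero    = cancel-0 rf (g 0) (trans (sym (+-identityʳ _)) (fg≈0 0))
    head-regular′ f rf g fg≈0 (suc n) = head-regular′ f rf (tail g) (λ k →
      trans (sym (trans (*ˢ-sucʳ f g k) (trans (+-congʳ (trans (*-congˡ g0≈0) (zeroʳ _))) (+-identityˡ _))))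
            (fg≈0 (suc k))) n
      where
      g0≈0 = head-regular′ f rf g fg≈0 zero

  t-regular : Regular (PowerSeries.commutativeRing R) t
  t-regular .cancel-0 g tg≈0 = eqˢ λ n → trans (sym (shift n)) (coeff≈ tg≈0 (suc n))
    where
    tail-t : ∀ n → tail t n ≈ 1ˢ n
    tail-t zero    = refl
    tail-t (suc _) = refl

    shift : ∀ n → (t *ˢ g) (suc n) ≈ g n
    shift n = trans (+-congʳ (zeroˡ _))
      (trans (+-identityˡ _) (trans (*ˢ-cong′ {g = g} tail-t (λ _ → refl) n) (*ˢ-identityˡ g n)))

  head-regular : ∀ (p : Polynomial) → Regular R (coeff p 0) → Regular (Polynomials.commutativeRing R) p
  head-regular p rp .cancel-0 q pq≈0 =
    eqᴾ (eqˢ (head-regular′ (coeff p) rp (coeff q) (coeff≈ (coeffs≈ pq≈0))))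

  indeterminate-regular : Regular (Polynomials.commutativeRing R) indeterminate
  indeterminate-regular .cancel-0 q tq≈0 = eqᴾ (cancel-0 t-regular (coeff q) (coeffs≈ tq≈0))

-- The field of fractions of R[[z⁻¹]] is the field R((z⁻¹)) of formal
-- Laurent series when R is a field.
module LaurentSeries (R : CommutativeRing c ℓ) where

  open PowerSeries R using (1ˢ; t; constant)
  open Fractions (PowerSeries.commutativeRing R) using (Fraction; _/_[_]; fromRing)

  commutativeRing : CommutativeRing (c ⊔ ℓ) ℓ
  commutativeRing = Fractions.commutativeRing (PowerSeries.commutativeRing R)

  -- The variable t of R[[t]] plays the role of z⁻¹, so a sequence a,
  -- viewed as a series, is Σ aₙ z⁻ⁿ.
  𝓩 : (ℕ → CommutativeRing.Carrier R) → Fraction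
  𝓩 a = fromRing a

  z : Fraction
  z = 1ˢ / t [ SeriesRegularity.t-regular R ]

  scalar : CommutativeRing.Carrier R → Fraction
  scalar a = fromRing (constant a)

module Fibopolynomials (K : CommutativeRing c ℓ) where

  K[x] K[x,y] K⟨x,y⟩ : CommutativeRing (c ⊔ ℓ) ℓ
  K[x]   = Polynomials.commutativeRing K
  K[x,y] = Polynomials.commutativeRing K[x]
  K⟨x,y⟩ = Fractions.commutativeRing K[x,y]

  private module A = CommutativeRing K[x]
  open CommutativeRing K[x,y] hiding (zero)
  open MonoidSum *-monoid using () renaming (sum to product)
  open Exp A.semiring using (_^_)
  open Regularity using (Regular; ≈-regular; ^-regular; product-regular)
  open Fractions K[x,y] using (Fraction; _/_[_]; fromRing)

  x y : Carrier
  x = Polynomials.constant K[x] (Polynomials.indeterminate K)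
  y = Polynomials.indeterminate K[x]

  F : ℕ → Carrier
  F zero          = 0#
  F (suc zero)    = 1#
  F (suc (suc n)) = x * F (suc n) + y * F n

  -- As a polynomial in y, F (n + 1) has constant term xⁿ.
  F-head : ∀ n → Polynomials.coeff (F (suc n)) 0 A.≈ Polynomials.indeterminate K ^ n
  F-head zero    = A.refl
  F-head (suc n) = A.trans
    (A.+-cong (A.+-identityʳ _) (A.trans (A.+-identityʳ _) (A.zeroˡ _)))
    (A.trans (A.+-identityʳ _) (A.*-congˡ (F-head n)))

  F-regular : ∀ n → .{{NonZero n}} → Regular K[x,y] (F n)
  F-regular (suc n) = SeriesRegularity.head-regular K[x] (F (suc n))
    (≈-regular K[x] (A.sym (F-head n))
      (^-regular K[x] (SeriesRegularity.indeterminate-regular K) n))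

  numerator : (s n k : ℕ) → Carrier
  numerator s n k = product {k} λ j → F (s ℕ.* (n ∸ toℕ j))

  denominator : (s k : ℕ) → Carrier
  denominator s k = product {k} λ j → F (s ℕ.* suc (toℕ j))

  denominator-regular : ∀ s → .{{NonZero s}} → ∀ k → Regular K[x,y] (denominator s k)
  denominator-regular s k = product-regular K[x,y] {k} (λ j → F (s ℕ.* suc (toℕ j))) λ j →
    F-regular (s ℕ.* suc (toℕ j)) {{ℕₚ.m*n≢0 s (suc (toℕ j))}}

  fibopolynomial : (s : ℕ) → .{{NonZero s}} → (n k : ℕ) → Fraction
  fibopolynomial s n k =
    if k ≤ᵇ n
    then numerator s n k / denominator s k [ denominator-regular s k ]
    else fromRing 0#

open Fibopolynomials ℂ-commutativeRing public
  using (y; fibopolynomial)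
open Fractions (Fibopolynomials.K[x,y] ℂ-commutativeRing) public
  using (fromRing)
open LaurentSeries (Fibopolynomials.K⟨x,y⟩ ℂ-commutativeRing) public
  using (𝓩; z; scalar)
open CommutativeRing (LaurentSeries.commutativeRing (Fibopolynomials.K⟨x,y⟩ ℂ-commutativeRing)) public
  using (_≈_; _*_; -_; 1#; semiring; +-monoid)
open Exp semiring public
  using (_^_)
open MonoidSum +-monoid public
  using (sum⁺-syntax)

{-# OPTIONS --safe #-}

-- Let α, β be the roots of u² = x u + y, a = αˢ, b = βˢ, so that
-- F(s(m+n)) = aᵐ F(sn) + bⁿ F(sm) and ab = (−y)ˢ =: Q.  This yields both Pascal
-- rules for B(n,k) = the s-Fibopolynomial, and with
--   Φₚ(t) = Σᵢ (−1)ⁱ Q^(i(i−1)/2) B(p,i) tⁱ   and   Hₚ(t) = Σₘ B(m+p,p) tᵐ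
-- they read Φₚ₊₁(t) = (1 − aᵖ t) Φₚ(b t) and (1 − aᵖ t) Hₚ(t) = Hₚ₋₁(b t), whence
-- Φₚ₊₁ Hₚ = 1 by induction on p.  With t = z⁻¹ the transform is tᵖ Hₚ, and the
-- denominator of the theorem is (−1)ˢ⁺¹ zᵖ⁺¹ Φₚ₊₁.  The roots are adjoined to the
-- coefficient ring, which embeds in the extension, so the identity descends.
module Submission where

open import Algebra.Bundles using (CommutativeRing)
open import Algebra.Definitions using (Invertible)
import Algebra.Morphism.Construct.Composition as Composition
open import Algebra.Morphism.Structures using (module RingMorphisms)
import Algebra.Properties.CommutativeSemiring.Exp as Exp
import Algebra.Properties.Monoid.Sum as MonoidSum
import Algebra.Properties.Ring as RingProperties
import Algebra.Properties.Semiring.Sum as SemiringSum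
import Algebra.Solver.Ring.NaturalCoefficients.Default as SemiringSolver
open import Algebra.Structures using (IsCommutativeRing)
open import Data.Bool.Base using (if_then_else_; true; false)
open import Data.Fin.Base as Fin using (Fin; toℕ; zero; suc)
import Data.Fin.Properties as Fin
open import Data.Nat.Base as ℕ using (ℕ; zero; suc; NonZero; _∸_; _/_; z≤n; s≤s)
open import Data.Nat.DivMod using (m*n/n≡m)
import Data.Nat.Properties as ℕ
import Data.Nat.Solver as ℕ-Solver
open import Data.Product.Base using (Σ-syntax; _,_; proj₁)
open import Data.Sum.Base using (inj₁; inj₂)
open import Defs using
  ( module PowerSeries; module Regularity; module Fractions; module SeriesRegularity
  ; module LaurentSeries; module Fibopolynomials)
open import Function.Base using (_∘_)
open import Level using (Level; _⊔_)
open import Relation.Binary.PropositionalEquality as ≡ using (_≡_)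
import Relation.Binary.Reasoning.Setoid as SetoidReasoning

-- Φₚ₊₁ Hₚ = 1 pairs the two q-binomial theorems, the finite product and its reciprocal series, in
-- homogeneous form with q = b/a. Homogeneity keeps everything polynomial in a and b: none of a, b,
-- a - b is ever inverted or cancelled, so the ring holding the roots need not be a domain. An
-- extension is unavoidable for this route because x² + 4y has no square root in ℂ(x,y). The formula
-- for B as a quotient of products serves to derive the absorption identity G(k+1) B(n+1,k+1) =
-- G(n+1) B(n,k) and the boundary values. These, with the cancellability of G(k+1), carry the rest;
-- unlike a quotient, they pass through any homomorphism that keeps the G(k+1) cancellable, and so
-- reach the extension. Invertibility of the denominator is not a separate problem: its inverse
-- turns out to be a unit times the transform itself.

private
  variable
    c ℓ c′ ℓ′ : Level

-- Ring homomorphisms.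

IsHomomorphism : (R : CommutativeRing c ℓ) (S : CommutativeRing c′ ℓ′) →
                 (CommutativeRing.Carrier R → CommutativeRing.Carrier S) → Set (c ⊔ ℓ ⊔ ℓ′)
IsHomomorphism R S = RingMorphisms.IsRingHomomorphism (CommutativeRing.rawRing R) (CommutativeRing.rawRing S)

module _ (R : CommutativeRing c ℓ) (S : CommutativeRing c′ ℓ′) where
  private
    module R = CommutativeRing R
    module S = CommutativeRing S

  mkIsHomomorphism : {h : R.Carrier → S.Carrier} →
    (∀ {u v} → u R.≈ v → h u S.≈ h v) →
    (∀ u v → h (u R.+ v) S.≈ h u S.+ h v) → h R.0# S.≈ S.0# →
    (∀ u v → h (u R.* v) S.≈ h u S.* h v) → h R.1# S.≈ S.1# →
    (∀ u → h (R.- u) S.≈ S.- h u) → IsHomomorphism R S h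
  mkIsHomomorphism cong +-homo 0-homo *-homo 1-homo neg-homo = record
    { isSemiringHomomorphism = record
      { isNearSemiringHomomorphism = record
        { +-isMonoidHomomorphism = record
          { isMagmaHomomorphism = record
            { isRelHomomorphism = record { cong = cong }
            ; homo = +-homo
            }
          ; ε-homo = 0-homo
          }
        ; *-homo = *-homo
        }
      ; 1#-homo = 1-homo
      }
    ; -‿homo = neg-homo
    }

  module Homomorphism {h : R.Carrier → S.Carrier} (isHomomorphism : IsHomomorphism R S h) where
    open RingMorphisms.IsRingHomomorphism isHomomorphism public
    private
      module Rᴱ = Exp R.commutativeSemiring
      module Sᴱ = Exp S.commutativeSemiring
      module Rˢ = MonoidSum R.+-monoid
      module Sˢ = MonoidSum S.+-monoid

    ^-homo : ∀ u n → h (u Rᴱ.^ n) S.≈ h u Sᴱ.^ n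
    ^-homo u zero    = 1#-homo
    ^-homo u (suc n) = S.trans (*-homo u _) (S.*-congˡ (^-homo u n))

    sum-homo : ∀ {n} (v : Fin n → R.Carrier) → h (Rˢ.sum v) S.≈ Sˢ.sum (h ∘ v)
    sum-homo {zero}  v = 0#-homo
    sum-homo {suc n} v = S.trans (+-homo _ _) (S.+-congˡ (sum-homo (v ∘ suc)))

    -1-homo : h (R.- R.1#) S.≈ S.- S.1#
    -1-homo = S.trans (-‿homo R.1#) (S.-‿cong 1#-homo)

-- Adjoining a root of u² = x u + y.

-- R[α] with α² = x α + y; ⟨ u , v ⟩ stands for u + v α.
module QuadraticExtension (R : CommutativeRing c ℓ) (x y : CommutativeRing.Carrier R) where

  open CommutativeRing R hiding (zero; isCommutativeRing)
  open SemiringSolver commutativeSemiring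
  open RingProperties ring using (-0#≈0#)

  record Element : Set c where
    constructor ⟨_,_⟩
    field
      base root : Carrier

  open Element

  infix 4 _≈ᴱ_
  record _≈ᴱ_ (u v : Element) : Set ℓ where
    constructor eqᴱ
    field
      base≈ : base u ≈ base v
      root≈ : root u ≈ root v

  open _≈ᴱ_

  infixl 6 _+ᴱ_
  infixl 7 _*ᴱ_
  _+ᴱ_ _*ᴱ_ : Element → Element → Element
  u +ᴱ v = ⟨ base u + base v , root u + root v ⟩
  u *ᴱ v = ⟨ base u * base v + y * (root u * root v)
           , base u * root v + root u * base v + x * (root u * root v) ⟩

  -ᴱ_ : Element → Element
  -ᴱ u = ⟨ - base u , - root u ⟩

  embed : Carrier → Element
  embed u = ⟨ u , 0# ⟩

  -- The second root is x - α, because the roots sum to x.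
  α β : Element
  α = ⟨ 0# , 1# ⟩
  β = ⟨ x , - 1# ⟩

  private
    *-assoc-base : ∀ x y a b c d e f →
      (a * c + y * (b * d)) * e + y * ((a * d + b * c + x * (b * d)) * f) ≈
      a * (c * e + y * (d * f)) + y * (b * (c * f + d * e + x * (d * f)))
    *-assoc-base = solve 8 (λ x y a b c d e f →
      (a :* c :+ y :* (b :* d)) :* e :+ y :* ((a :* d :+ b :* c :+ x :* (b :* d)) :* f) :=
      a :* (c :* e :+ y :* (d :* f)) :+ y :* (b :* (c :* f :+ d :* e :+ x :* (d :* f)))) refl

    *-assoc-root : ∀ x y a b c d e f →
      (a * c + y * (b * d)) * f + (a * d + b * c + x * (b * d)) * e
        + x * ((a * d + b * c + x * (b * d)) * f) ≈
      a * (c * f + d * e + x * (d * f)) + b * (c * e + y * (d * f))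
        + x * (b * (c * f + d * e + x * (d * f)))
    *-assoc-root = solve 8 (λ x y a b c d e f →
      (a :* c :+ y :* (b :* d)) :* f :+ (a :* d :+ b :* c :+ x :* (b :* d)) :* e
        :+ x :* ((a :* d :+ b :* c :+ x :* (b :* d)) :* f) :=
      a :* (c :* f :+ d :* e :+ x :* (d :* f)) :+ b :* (c :* e :+ y :* (d :* f))
        :+ x :* (b :* (c :* f :+ d :* e :+ x :* (d :* f)))) refl

    *-comm-base : ∀ y a b c d → a * c + y * (b * d) ≈ c * a + y * (d * b)
    *-comm-base = solve 5 (λ y a b c d → a :* c :+ y :* (b :* d) := c :* a :+ y :* (d :* b)) refl

    *-comm-root : ∀ x a b c d → a * d + b * c + x * (b * d) ≈ c * b + d * a + x * (d * b)
    *-comm-root = solve 5 (λ x a b c d →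
      a :* d :+ b :* c :+ x :* (b :* d) := c :* b :+ d :* a :+ x :* (d :* b)) refl

    *-identityˡ-base : ∀ y a b → 1# * a + y * (0# * b) ≈ a
    *-identityˡ-base = solve 3 (λ y a b → con 1 :* a :+ y :* (con 0 :* b) := a) refl

    *-identityˡ-root : ∀ x a b → 1# * b + 0# * a + x * (0# * b) ≈ b
    *-identityˡ-root = solve 3 (λ x a b → con 1 :* b :+ con 0 :* a :+ x :* (con 0 :* b) := b) refl

    distribʳ-base : ∀ y a b c d e f →
      (c + e) * a + y * ((d + f) * b) ≈ (c * a + y * (d * b)) + (e * a + y * (f * b))
    distribʳ-base = solve 7 (λ y a b c d e f →
      (c :+ e) :* a :+ y :* ((d :+ f) :* b) :=
      (c :* a :+ y :* (d :* b)) :+ (e :* a :+ y :* (f :* b))) refl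

    distribʳ-root : ∀ x a b c d e f →
      (c + e) * b + (d + f) * a + x * ((d + f) * b) ≈
      (c * b + d * a + x * (d * b)) + (e * b + f * a + x * (f * b))
    distribʳ-root = solve 7 (λ x a b c d e f →
      (c :+ e) :* b :+ (d :+ f) :* a :+ x :* ((d :+ f) :* b) :=
      (c :* b :+ d :* a :+ x :* (d :* b)) :+ (e :* b :+ f :* a :+ x :* (f :* b))) refl

    *-distribʳ : ∀ u v w → (v +ᴱ w) *ᴱ u ≈ᴱ (v *ᴱ u) +ᴱ (w *ᴱ u)
    *-distribʳ ⟨ a , b ⟩ ⟨ c , d ⟩ ⟨ e , f ⟩ = eqᴱ (distribʳ-base y a b c d e f) (distribʳ-root x a b c d e f)

    *-comm′ : ∀ u v → u *ᴱ v ≈ᴱ v *ᴱ u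
    *-comm′ ⟨ a , b ⟩ ⟨ c , d ⟩ = eqᴱ (*-comm-base y a b c d) (*-comm-root x a b c d)

    *-identityˡ′ : ∀ u → embed 1# *ᴱ u ≈ᴱ u
    *-identityˡ′ ⟨ a , b ⟩ = eqᴱ (*-identityˡ-base y a b) (*-identityˡ-root x a b)

    trans′ : ∀ {u v w} → u ≈ᴱ v → v ≈ᴱ w → u ≈ᴱ w
    trans′ p q = eqᴱ (trans (base≈ p) (base≈ q)) (trans (root≈ p) (root≈ q))

    +-cong′ : ∀ {u u′ v v′} → u ≈ᴱ u′ → v ≈ᴱ v′ → u +ᴱ v ≈ᴱ u′ +ᴱ v′
    +-cong′ p q = eqᴱ (+-cong (base≈ p) (base≈ q)) (+-cong (root≈ p) (root≈ q))

  abstract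
    isCommutativeRing : IsCommutativeRing _≈ᴱ_ _+ᴱ_ _*ᴱ_ -ᴱ_ (embed 0#) (embed 1#)
    isCommutativeRing = record
      { isRing = record
        { +-isAbelianGroup = record
          { isGroup = record
            { isMonoid = record
              { isSemigroup = record
                { isMagma = record
                  { isEquivalence = record
                    { refl  = eqᴱ refl refl
                    ; sym   = λ p → eqᴱ (sym (base≈ p)) (sym (root≈ p))
                    ; trans = trans′
                    }
                  ; ∙-cong = +-cong′
                  }
                ; assoc = λ _ _ _ → eqᴱ (+-assoc _ _ _) (+-assoc _ _ _)
                }
              ; identity = (λ _ → eqᴱ (+-identityˡ _) (+-identityˡ _))
                         , (λ _ → eqᴱ (+-identityʳ _) (+-identityʳ _))
              }
            ; inverse = (λ _ → eqᴱ (-‿inverseˡ _) (-‿inverseˡ _))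
                      , (λ _ → eqᴱ (-‿inverseʳ _) (-‿inverseʳ _))
            ; ⁻¹-cong = λ p → eqᴱ (-‿cong (base≈ p)) (-‿cong (root≈ p))
            }
          ; comm = λ _ _ → eqᴱ (+-comm _ _) (+-comm _ _)
          }
        ; *-cong = λ p q → eqᴱ
            (+-cong (*-cong (base≈ p) (base≈ q)) (*-congˡ (*-cong (root≈ p) (root≈ q))))
            (+-cong (+-cong (*-cong (base≈ p) (root≈ q)) (*-cong (root≈ p) (base≈ q)))
                    (*-congˡ (*-cong (root≈ p) (root≈ q))))
        ; *-assoc = λ { ⟨ a , b ⟩ ⟨ c , d ⟩ ⟨ e , f ⟩ →
            eqᴱ (*-assoc-base x y a b c d e f) (*-assoc-root x y a b c d e f) }
        ; *-identity = *-identityˡ′ , λ u → trans′ (*-comm′ u _) (*-identityˡ′ u)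
        ; distrib = (λ u v w → trans′ (*-comm′ u _) (trans′ (*-distribʳ u v w)
                       (+-cong′ (*-comm′ v u) (*-comm′ w u)))) , *-distribʳ
        }
      ; *-comm = *-comm′
      }

  commutativeRing : CommutativeRing c ℓ
  commutativeRing = record { isCommutativeRing = isCommutativeRing }

  embed-isHomomorphism : IsHomomorphism R commutativeRing embed
  embed-isHomomorphism = mkIsHomomorphism R commutativeRing
    (λ p → eqᴱ p refl)
    (λ _ _ → eqᴱ refl (sym (+-identityˡ 0#)))
    (eqᴱ refl refl)
    (λ u v → eqᴱ
      (solve 3 (λ y u v → u :* v := u :* v :+ y :* (con 0 :* con 0)) refl y u v)
      (solve 3 (λ x u v → con 0 := u :* con 0 :+ con 0 :* v :+ x :* (con 0 :* con 0)) refl x u v))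
    (eqᴱ refl refl)
    (λ _ → eqᴱ refl (sym -0#≈0#))

  embed-injective : ∀ {u v} → embed u ≈ᴱ embed v → u ≈ v
  embed-injective = base≈

  -- Multiplication by `embed u` multiplies both coordinates by u, so cancellation happens
  -- coordinatewise.
  embed-regular : ∀ {u} → Regularity.Regular R u → Regularity.Regular commutativeRing (embed u)
  embed-regular {u} ru .Regularity.cancel-0 ⟨ v , w ⟩ p = eqᴱ
    (Regularity.cancel-0 ru v (trans
      (solve 4 (λ y u v w → u :* v := u :* v :+ y :* (con 0 :* w)) refl y u v w) (base≈ p)))
    (Regularity.cancel-0 ru w (trans
      (solve 4 (λ x u v w → u :* w := u :* w :+ con 0 :* v :+ x :* (con 0 :* w)) refl x u v w) (root≈ p)))

  -- Vieta's relations: this and `α*β` are the form in which the two roots enter the addition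
  -- formula.
  α+β : α +ᴱ β ≈ᴱ embed x
  α+β = eqᴱ (+-identityˡ x) (-‿inverseʳ 1#)

  α*β : α *ᴱ β ≈ᴱ embed (- 1# * y)
  α*β = eqᴱ
    (solve 3 (λ x y n → con 0 :* x :+ y :* (con 1 :* n) := n :* y) refl x y (- 1#))
    (trans (solve 2 (λ x n → con 0 :* n :+ con 1 :* x :+ x :* (con 1 :* n) := (con 1 :+ n) :* x)
              refl x (- 1#))
           (trans (*-congʳ (-‿inverseʳ 1#)) (zeroˡ x)))

-- Addition formula for Fibonacci-like sequences.

module AdditionFormula (A : CommutativeRing c ℓ) where

  open CommutativeRing A hiding (zero)
  open Exp commutativeSemiring
  open SemiringSolver commutativeSemiring hiding (_:^_)
  open SetoidReasoning setoid

  -- Every multiple of aⁿ - bⁿ satisfies this, since a^(m+n) - b^(m+n) = aᵐ(aⁿ - bⁿ) + bⁿ(aᵐ - bᵐ).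
  -- It replaces Binet's formula and spares the division by a - b.
  HasAdditionFormula : Carrier → Carrier → (ℕ → Carrier) → Set ℓ
  HasAdditionFormula a b f = ∀ m n → f (m ℕ.+ n) ≈ a ^ m * f n + b ^ n * f m

  fibonacci-addition : ∀ {x y a b f} → a + b ≈ x → a * b ≈ - 1# * y →
    f 0 ≈ 0# → f 1 ≈ 1# → (∀ n → f (suc (suc n)) ≈ x * f (suc n) + y * f n) →
    HasAdditionFormula a b f
  fibonacci-addition {x} {y} {a} {b} {f} a+b≈x ab≈-y f0 f1 f-rec = addition
    where
    ab+y≈0 : a * b + y ≈ 0#
    ab+y≈0 = begin
      a * b + y          ≈⟨ +-congʳ ab≈-y ⟩
      - 1# * y + y       ≈⟨ solve 2 (λ n y → n :* y :+ y := (n :+ con 1) :* y) refl (- 1#) y ⟩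
      (- 1# + 1#) * y    ≈⟨ *-congʳ (-‿inverseˡ 1#) ⟩
      0# * y             ≈⟨ zeroˡ y ⟩
      0#                 ∎

    -- With x = a + b and y = -ab, the term b(av) coming from b u cancels y v. The case w = 0
    -- handles the powers of a, the case w = bⁿ handles f.
    recurrence-step : ∀ u v w → u ≈ a * v + w → x * u + y * v ≈ a * u + b * w
    recurrence-step u v w u≈av+w = begin
      x * u + y * v
        ≈⟨ +-congʳ (*-congʳ a+b≈x) ⟨
      (a + b) * u + y * v
        ≈⟨ solve 5 (λ a b u y v → (a :+ b) :* u :+ y :* v := a :* u :+ (b :* u :+ y :* v)) refl a b u y v ⟩
      a * u + (b * u + y * v)
        ≈⟨ +-congˡ (+-congʳ (*-congˡ u≈av+w)) ⟩
      a * u + (b * (a * v + w) + y * v)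
        ≈⟨ +-congˡ (solve 5 (λ a b y v w →
             b :* (a :* v :+ w) :+ y :* v := b :* w :+ (a :* b :+ y) :* v) refl a b y v w) ⟩
      a * u + (b * w + (a * b + y) * v)
        ≈⟨ +-congˡ (+-congˡ (trans (*-congʳ ab+y≈0) (zeroˡ v))) ⟩
      a * u + (b * w + 0#)
        ≈⟨ +-congˡ (+-identityʳ _) ⟩
      a * u + b * w ∎

    power-step : ∀ n → x * a ^ suc n + y * a ^ n ≈ a ^ suc (suc n)
    power-step n = begin
      x * a ^ suc n + y * a ^ n  ≈⟨ recurrence-step (a ^ suc n) (a ^ n) 0# (sym (+-identityʳ _)) ⟩
      a * a ^ suc n + b * 0#     ≈⟨ trans (+-congˡ (zeroʳ b)) (+-identityʳ _) ⟩
      a ^ suc (suc n)            ∎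

    -- The second-order recurrence factors: f(n+1) - a f(n) is geometric with ratio b. This is the
    -- addition formula for m = 1.
    f-suc : ∀ n → f (suc n) ≈ a * f n + b ^ n
    f-suc zero    = begin
      f 1             ≈⟨ f1 ⟩
      1#              ≈⟨ solve 1 (λ a → con 1 := a :* con 0 :+ con 1) refl a ⟩
      a * 0# + 1#     ≈⟨ +-congʳ (*-congˡ f0) ⟨
      a * f 0 + b ^ 0 ∎
    f-suc (suc n) = trans (f-rec n) (recurrence-step (f (suc n)) (f n) (b ^ n) (f-suc n))

    addition : HasAdditionFormula a b f
    addition zero n = begin
      f n                       ≈⟨ solve 2 (λ u w → u := con 1 :* u :+ w :* con 0) refl _ (b ^ n) ⟩
      1# * f n + b ^ n * 0#     ≈⟨ +-congˡ (*-congˡ f0) ⟨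
      1# * f n + b ^ n * f 0    ∎
    addition (suc zero) n = begin
      f (suc n)                         ≈⟨ f-suc n ⟩
      a * f n + b ^ n                   ≈⟨ solve 3 (λ a u w → a :* u :+ w := a :* con 1 :* u :+ w :* con 1) refl a _ (b ^ n) ⟩
      a * 1# * f n + b ^ n * 1#         ≈⟨ +-congˡ (*-congˡ f1) ⟨
      a * 1# * f n + b ^ n * f 1        ∎
    -- For fixed n both sides satisfy the same second-order recurrence in m, hence the two base
    -- cases.
    addition (suc (suc m)) n = begin
      f (suc (suc (m ℕ.+ n)))
        ≈⟨ f-rec (m ℕ.+ n) ⟩
      x * f (suc m ℕ.+ n) + y * f (m ℕ.+ n)
        ≈⟨ +-cong (*-congˡ (addition (suc m) n)) (*-congˡ (addition m n)) ⟩
      x * (a ^ suc m * f n + b ^ n * f (suc m)) + y * (a ^ m * f n + b ^ n * f m)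
        ≈⟨ solve 8 (λ x y p q u w v v′ →
             x :* (p :* u :+ w :* v) :+ y :* (q :* u :+ w :* v′) :=
             (x :* p :+ y :* q) :* u :+ w :* (x :* v :+ y :* v′)) refl
             x y (a ^ suc m) (a ^ m) (f n) (b ^ n) (f (suc m)) (f m) ⟩
      (x * a ^ suc m + y * a ^ m) * f n + b ^ n * (x * f (suc m) + y * f m)
        ≈⟨ +-cong (*-congʳ (power-step m)) (*-congˡ (sym (f-rec m))) ⟩
      a ^ suc (suc m) * f n + b ^ n * f (suc (suc m)) ∎

  dilate-addition : ∀ {a b f} → HasAdditionFormula a b f →
    ∀ s → HasAdditionFormula (a ^ s) (b ^ s) (λ n → f (s ℕ.* n))
  dilate-addition {a} {b} {f} add s m n = begin
    f (s ℕ.* (m ℕ.+ n))                                    ≡⟨ ≡.cong f (ℕ.*-distribˡ-+ s m n) ⟩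
    f (s ℕ.* m ℕ.+ s ℕ.* n)                                ≈⟨ add (s ℕ.* m) (s ℕ.* n) ⟩
    a ^ (s ℕ.* m) * f (s ℕ.* n) + b ^ (s ℕ.* n) * f (s ℕ.* m)
      ≈⟨ +-cong (*-congʳ (^-assocʳ a s m)) (*-congʳ (^-assocʳ b s n)) ⟨
    (a ^ s) ^ m * f (s ℕ.* n) + (b ^ s) ^ n * f (s ℕ.* m)  ∎

  -- Commutativity of m + n exchanges a and b; one proof thus yields both Pascal rules.
  addition-swap : ∀ {a b f} → HasAdditionFormula a b f → HasAdditionFormula b a f
  addition-swap {f = f} add m n = trans (reflexive (≡.cong f (ℕ.+-comm m n))) (trans (add n m) (+-comm _ _))

-- Generalised binomial coefficients and their Pascal rules.

module _ (R : CommutativeRing c ℓ) where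
  open CommutativeRing R hiding (zero)
  open Exp commutativeSemiring
  open Regularity R using (Regular)

  -- These data determine B, because G(k+1) can be cancelled in `absorption`. Apart from regularity
  -- they are equations without division, which any homomorphism preserves.
  record IsBinomialTriangle (G : ℕ → Carrier) (B : ℕ → ℕ → Carrier) : Set (c ⊔ ℓ) where
    field
      G-zero     : G 0 ≈ 0#
      G-regular  : ∀ n → Regular (G (suc n))
      B-zeroʳ    : ∀ n → B n 0 ≈ 1#
      B-zero-suc : ∀ k → B 0 (suc k) ≈ 0#
      absorption : ∀ n k → G (suc k) * B (suc n) (suc k) ≈ G (suc n) * B n k

  -- weight Q i = (−1)ⁱ Q^(i(i−1)/2), with −1 kept as a factor so that the semiring
  -- solver can treat it as an atom.
  weight : Carrier → ℕ → Carrier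
  weight Q zero    = 1#
  weight Q (suc i) = - 1# * (Q ^ i * weight Q i)

module BinomialTriangle (R : CommutativeRing c ℓ)
  {G : ℕ → CommutativeRing.Carrier R} {B : ℕ → ℕ → CommutativeRing.Carrier R}
  (triangle : IsBinomialTriangle R G B) where

  open CommutativeRing R hiding (zero)
  open Exp commutativeSemiring
  open SemiringSolver commutativeSemiring hiding (_:^_)
  open SetoidReasoning setoid
  open Regularity R
  open AdditionFormula R
  open IsBinomialTriangle triangle

  vanishing : ∀ n k → n ℕ.< k → B n k ≈ 0#
  vanishing zero    (suc k) _         = B-zero-suc k
  vanishing (suc n) (suc k) (s≤s n<k) = cancel-0 (G-regular k) _ (begin
    G (suc k) * B (suc n) (suc k)  ≈⟨ absorption n k ⟩
    G (suc n) * B n k              ≈⟨ *-congˡ (vanishing n k n<k) ⟩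
    G (suc n) * 0#                 ≈⟨ zeroʳ _ ⟩
    0#                             ∎)

  -- The analogue of (k+1) C(n,k+1) = (n-k) C(n,k), with n = m + k to avoid subtraction.
  horizontal-absorption : ∀ m k → G (suc k) * B (m ℕ.+ k) (suc k) ≈ G m * B (m ℕ.+ k) k
  horizontal-absorption zero k = begin
    G (suc k) * B k (suc k)  ≈⟨ *-congˡ (vanishing k (suc k) ℕ.≤-refl) ⟩
    G (suc k) * 0#           ≈⟨ zeroʳ _ ⟩
    0#                       ≈⟨ zeroˡ _ ⟨
    0# * B k k               ≈⟨ *-congʳ G-zero ⟨
    G 0 * B k k              ∎
  horizontal-absorption (suc m) zero = begin
    G 1 * B (suc m ℕ.+ 0) 1        ≈⟨ absorption (m ℕ.+ 0) 0 ⟩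
    G (suc m ℕ.+ 0) * B (m ℕ.+ 0) 0
      ≈⟨ *-cong (reflexive (≡.cong G (ℕ.+-identityʳ (suc m)))) (trans (B-zeroʳ _) (sym (B-zeroʳ _))) ⟩
    G (suc m) * B (suc m ℕ.+ 0) 0  ∎
  -- The extra factor G(k+1) lets `absorption` lower both sides to row m + k, where the induction
  -- hypothesis applies; it is cancelled at the end.
  horizontal-absorption m@(suc _) (suc k) = regular⇒cancel (G-regular k) (begin
    g * (G (2 ℕ.+ k) * B (m ℕ.+ suc k) (2 ℕ.+ k))        ≡⟨ ≡.cong (λ n → g * (G (2 ℕ.+ k) * B n (2 ℕ.+ k))) (ℕ.+-suc m k) ⟩
    g * (G (2 ℕ.+ k) * B (suc (m ℕ.+ k)) (2 ℕ.+ k))      ≈⟨ *-congˡ (absorption (m ℕ.+ k) (suc k)) ⟩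
    g * (G (suc (m ℕ.+ k)) * B (m ℕ.+ k) (suc k))        ≈⟨ swap _ _ _ ⟩
    G (suc (m ℕ.+ k)) * (g * B (m ℕ.+ k) (suc k))        ≈⟨ *-congˡ (horizontal-absorption m k) ⟩
    G (suc (m ℕ.+ k)) * (G m * B (m ℕ.+ k) k)            ≈⟨ swap _ _ _ ⟩
    G m * (G (suc (m ℕ.+ k)) * B (m ℕ.+ k) k)            ≈⟨ *-congˡ (absorption (m ℕ.+ k) k) ⟨
    G m * (g * B (suc (m ℕ.+ k)) (suc k))                ≈⟨ swap _ _ _ ⟩
    g * (G m * B (suc (m ℕ.+ k)) (suc k))                ≡⟨ ≡.cong (λ n → g * (G m * B n (suc k))) (ℕ.+-suc m k) ⟨
    g * (G m * B (m ℕ.+ suc k) (suc k))                  ∎)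
    where
    g = G (suc k)
    swap : ∀ u v w → u * (v * w) ≈ v * (u * w)
    swap = solve 3 (λ u v w → u :* (v :* w) := v :* (u :* w)) refl

  -- Absorption leaves G(m+k+1) B(m+k,k). The addition formula splits the first factor into parts
  -- with G(k+1) and G(m); horizontal absorption gives the second part a factor G(k+1) too, which is
  -- then cancelled.
  pascal : ∀ {a b} → HasAdditionFormula a b G → ∀ m k →
    B (suc (m ℕ.+ k)) (suc k) ≈ a ^ suc k * B (m ℕ.+ k) (suc k) + b ^ m * B (m ℕ.+ k) k
  pascal {a} {b} add m k = regular⇒cancel (G-regular k) (begin
    G (suc k) * B (suc (m ℕ.+ k)) (suc k)
      ≈⟨ absorption (m ℕ.+ k) k ⟩
    G (suc (m ℕ.+ k)) * B (m ℕ.+ k) k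
      ≡⟨ ≡.cong (λ n → G n * B (m ℕ.+ k) k) (ℕ.+-suc m k) ⟨
    G (m ℕ.+ suc k) * B (m ℕ.+ k) k
      ≈⟨ *-congʳ (addition-swap add m (suc k)) ⟩
    (b ^ m * G (suc k) + a ^ suc k * G m) * B (m ℕ.+ k) k
      ≈⟨ solve 5 (λ p g q h u → (p :* g :+ q :* h) :* u := q :* (h :* u) :+ g :* (p :* u)) refl
           (b ^ m) (G (suc k)) (a ^ suc k) (G m) (B (m ℕ.+ k) k) ⟩
    a ^ suc k * (G m * B (m ℕ.+ k) k) + G (suc k) * (b ^ m * B (m ℕ.+ k) k)
      ≈⟨ +-congʳ (*-congˡ (horizontal-absorption m k)) ⟨
    a ^ suc k * (G (suc k) * B (m ℕ.+ k) (suc k)) + G (suc k) * (b ^ m * B (m ℕ.+ k) k)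
      ≈⟨ solve 4 (λ q g u v → q :* (g :* u) :+ g :* v := g :* (q :* u :+ v)) refl
           (a ^ suc k) (G (suc k)) _ _ ⟩
    G (suc k) * (a ^ suc k * B (m ℕ.+ k) (suc k) + b ^ m * B (m ℕ.+ k) k) ∎)

  -- Multiplying by aᵏ clears the negative power in Pascal's a^(n−k), so that k > n is allowed.
  pascal-scaled : ∀ {a b} → HasAdditionFormula a b G → ∀ n k →
    a ^ k * B (suc n) (suc k) ≈ a ^ k * (b ^ suc k * B n (suc k)) + a ^ n * B n k
  pascal-scaled {a} {b} add n k with ℕ.≤-<-connex k n
  ... | inj₁ k≤n = ≡.subst Scaled (ℕ.m∸n+n≡m k≤n) (begin
    a ^ k * B (suc (m ℕ.+ k)) (suc k)
      ≈⟨ *-congˡ (pascal (addition-swap add) m k) ⟩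
    a ^ k * (b ^ suc k * B (m ℕ.+ k) (suc k) + a ^ m * B (m ℕ.+ k) k)
      ≈⟨ solve 4 (λ p u q v → p :* (u :+ q :* v) := p :* u :+ (q :* p) :* v) refl (a ^ k) _ (a ^ m) _ ⟩
    a ^ k * (b ^ suc k * B (m ℕ.+ k) (suc k)) + a ^ m * a ^ k * B (m ℕ.+ k) k
      ≈⟨ +-congˡ (*-congʳ (^-homo-* a m k)) ⟨
    a ^ k * (b ^ suc k * B (m ℕ.+ k) (suc k)) + a ^ (m ℕ.+ k) * B (m ℕ.+ k) k ∎)
    where
    m = n ∸ k
    Scaled : ℕ → Set _
    Scaled n = a ^ k * B (suc n) (suc k) ≈ a ^ k * (b ^ suc k * B n (suc k)) + a ^ n * B n k
  ... | inj₂ n<k = begin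
    a ^ k * B (suc n) (suc k)
      ≈⟨ *-congˡ (vanishing (suc n) (suc k) (s≤s n<k)) ⟩
    a ^ k * 0#
      ≈⟨ solve 3 (λ p q r → p :* con 0 := p :* (q :* con 0) :+ r :* con 0) refl (a ^ k) (b ^ suc k) (a ^ n) ⟩
    a ^ k * (b ^ suc k * 0#) + a ^ n * 0#
      ≈⟨ +-cong (*-congˡ (*-congˡ (vanishing n (suc k) (ℕ.m≤n⇒m≤1+n n<k)))) (*-congˡ (vanishing n k n<k)) ⟨
    a ^ k * (b ^ suc k * B n (suc k)) + a ^ n * B n k ∎

-- Finite sums and formal power series.

module RingLemmas (R : CommutativeRing c ℓ) where

  open CommutativeRing R hiding (zero)
  open Exp commutativeSemiring
  open SemiringSolver commutativeSemiring hiding (_:^_)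
  open SetoidReasoning setoid
  open SemiringSum semiring using (sum; sum-cong-≋; *-distribˡ-sum)

  sum-zero : ∀ {n} (v : Fin n → Carrier) → (∀ i → v i ≈ 0#) → sum v ≈ 0#
  sum-zero {zero}  v v≈0 = refl
  sum-zero {suc n} v v≈0 = trans (+-cong (v≈0 zero) (sum-zero (v ∘ suc) (v≈0 ∘ suc))) (+-identityˡ 0#)

  -- With r k the k-th tail of a series and τ = t, this is truncation at degree N with its
  -- remainder.
  expansion : ∀ τ (a r : ℕ → Carrier) → (∀ k → r k ≈ a k + τ * r (suc k)) →
    ∀ N → r 0 ≈ sum {N} (λ i → a (toℕ i) * τ ^ toℕ i) + τ ^ N * r N
  expansion τ a r r-suc zero    = solve 1 (λ u → u := con 0 :+ con 1 :* u) refl _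
  expansion τ a r r-suc (suc N) = begin
    r 0
      ≈⟨ r-suc 0 ⟩
    a 0 + τ * r 1
      ≈⟨ +-congˡ (*-congˡ (expansion τ (a ∘ suc) (r ∘ suc) (r-suc ∘ suc) N)) ⟩
    a 0 + τ * (Σ + τ ^ N * r (suc N))
      ≈⟨ solve 5 (λ a τ s p u → a :+ τ :* (s :+ p :* u) := a :* con 1 :+ τ :* s :+ (τ :* p) :* u) refl
           (a 0) τ Σ (τ ^ N) (r (suc N)) ⟩
    a 0 * 1# + τ * Σ + τ ^ suc N * r (suc N)
      ≈⟨ +-congʳ (+-congˡ (trans (*-distribˡ-sum {N} τ (λ i → a (suc (toℕ i)) * τ ^ toℕ i)) (sum-cong-≋ {N} λ i →
           solve 3 (λ τ a p → τ :* (a :* p) := a :* (τ :* p)) refl τ (a (suc (toℕ i))) (τ ^ toℕ i)))) ⟩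
    a 0 * 1# + sum {N} (λ i → a (suc (toℕ i)) * τ ^ suc (toℕ i)) + τ ^ suc N * r (suc N) ∎
    where Σ = sum {N} λ i → a (suc (toℕ i)) * τ ^ toℕ i

  -- The inductive step for Φₚ₊₁ Hₚ = 1: the linear factor l split off from Φ is absorbed by H.
  cancel-factor : ∀ f′ l f h g → f′ ≈ l * f → l * h ≈ g → f * g ≈ 1# → f′ * h ≈ 1#
  cancel-factor f′ l f h g f′≈lf lh≈g fg≈1 = begin
    f′ * h       ≈⟨ *-congʳ f′≈lf ⟩
    l * f * h    ≈⟨ solve 3 (λ l f h → l :* f :* h := f :* (l :* h)) refl l f h ⟩
    f * (l * h)  ≈⟨ *-congˡ lh≈g ⟩
    f * g        ≈⟨ fg≈1 ⟩
    1#           ∎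

module SeriesLemmas (R : CommutativeRing c ℓ) where

  open CommutativeRing R hiding (zero)
  open Exp commutativeSemiring
  open SemiringSolver commutativeSemiring hiding (_:^_)
  open SetoidReasoning setoid
  open RingProperties ring using (-0#≈0#)
  open PowerSeries R

  private
    module S = CommutativeRing (PowerSeries.commutativeRing R)
    module Sᴱ = Exp S.commutativeSemiring
    module Sˢ = MonoidSum S.+-monoid

  constant-*ˢ : ∀ a f n → (constant a *ˢ f) n ≈ a * f n
  constant-*ˢ a f zero    = +-identityʳ _
  constant-*ˢ a f (suc n) = trans (+-congˡ (*ˢ-zeroˡ f (λ _ → refl) n)) (+-identityʳ _)

  constant-isHomomorphism : IsHomomorphism R (PowerSeries.commutativeRing R) constant
  constant-isHomomorphism = mkIsHomomorphism R (PowerSeries.commutativeRing R)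
    (λ p → eqˢ λ { zero → p ; (suc _) → refl })
    (λ _ _ → eqˢ λ { zero → refl ; (suc _) → sym (+-identityˡ 0#) })
    (eqˢ λ { zero → refl ; (suc _) → refl })
    (λ u v → eqˢ λ { zero    → sym (constant-*ˢ u (constant v) 0)
                   ; (suc n) → sym (trans (constant-*ˢ u (constant v) (suc n)) (zeroʳ u)) })
    (eqˢ λ { zero → refl ; (suc _) → refl })
    (λ _ → eqˢ λ { zero → refl ; (suc _) → sym -0#≈0# })

  t-*ˢ-zero : ∀ f → (t *ˢ f) 0 ≈ 0#
  t-*ˢ-zero f = trans (+-identityʳ _) (zeroˡ _)

  t-*ˢ-suc : ∀ f n → (t *ˢ f) (suc n) ≈ f n
  t-*ˢ-suc f n = trans (+-cong (zeroˡ _) (*ˢ-cong′ {g = f} tail-t (λ _ → refl) n))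
                       (trans (+-identityˡ _) (*ˢ-identityˡ f n))
    where
    tail-t : ∀ n → tail t n ≈ 1ˢ n
    tail-t zero    = refl
    tail-t (suc _) = refl

  constant+t*tail : ∀ f → f S.≈ constant (f 0) S.+ t S.* tail f
  constant+t*tail f = eqˢ λ
    { zero    → sym (trans (+-congˡ (t-*ˢ-zero (tail f))) (+-identityʳ _))
    ; (suc n) → sym (trans (+-congˡ (t-*ˢ-suc (tail f) n)) (+-identityˡ _))
    }

  private
    -- `finite-series` follows when the remainder vanishes, `factor-t^` when the truncated part
    -- does.
    series-expansion : ∀ f N → f S.≈ (Sˢ.sum {N} λ i → constant (f (toℕ i)) S.* t Sᴱ.^ toℕ i)
                                     S.+ t Sᴱ.^ N S.* (λ m → f (N ℕ.+ m))
    series-expansion f N = expansion t (λ k → constant (f k)) (λ k m → f (k ℕ.+ m))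
      (λ k → S.trans {i = λ m → f (k ℕ.+ m)} (constant+t*tail (λ m → f (k ℕ.+ m))) (eqˢ λ n →
        +-cong (reflexive (≡.cong (λ j → constant (f j) n) (ℕ.+-identityʳ k)))
               (*ˢ-cong′ {f = t} (λ _ → refl) (λ m → reflexive (≡.cong f (ℕ.+-suc k m))) n))) N
      where open RingLemmas (PowerSeries.commutativeRing R)

  finite-series : ∀ N f → VanishesFrom N f →
    f S.≈ Sˢ.sum {N} λ i → constant (f (toℕ i)) S.* t Sᴱ.^ toℕ i
  finite-series N f f≈0 = eqˢ λ n → trans (coeff≈ (series-expansion f N) n)
    (trans (+-congˡ (trans (*ˢ-comm (t Sᴱ.^ N) (λ m → f (N ℕ.+ m)) n)
                           (*ˢ-zeroˡ (t Sᴱ.^ N) (λ m → f≈0 (N ℕ.+ m) (ℕ.m≤m+n N m)) n)))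
           (+-identityʳ _))

  factor-t^ : ∀ N f → (∀ n → n ℕ.< N → f n ≈ 0#) → f S.≈ t Sᴱ.^ N S.* (λ m → f (N ℕ.+ m))
  factor-t^ N f f≈0 = eqˢ λ n → trans (coeff≈ (series-expansion f N) n)
    (trans (+-congʳ (coeff≈ (sum-zero (λ i → constant (f (toℕ i)) S.* t Sᴱ.^ toℕ i) λ i →
              eqˢ (*ˢ-zeroˡ {constant (f (toℕ i))} (t Sᴱ.^ toℕ i)
                     λ { zero → f≈0 (toℕ i) (Fin.toℕ<n i) ; (suc _) → refl })) n))
           (+-identityˡ _))
    where open RingLemmas (PowerSeries.commutativeRing R)

  1-_t : Carrier → Series
  1- a t = λ { zero → 1# ; (suc zero) → - 1# * a ; (suc (suc _)) → 0# }

  1-at-*ˢ-suc : ∀ a f n → (1- a t *ˢ f) (suc n) ≈ f (suc n) + - 1# * a * f n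
  1-at-*ˢ-suc a f n = +-cong (*-identityˡ _) (trans
    (*ˢ-cong′ {f = tail 1- a t} {constant (- 1# * a)} {f} (λ { zero → refl ; (suc _) → refl }) (λ _ → refl) n)
    (constant-*ˢ (- 1# * a) f n))

  infixr 8 _▹_
  -- The substitution f(b t).
  _▹_ : Carrier → Series → Series
  (b ▹ f) n = b ^ n * f n

  ▹-1ˢ : ∀ b n → (b ▹ 1ˢ) n ≈ 1ˢ n
  ▹-1ˢ b zero    = *-identityˡ 1#
  ▹-1ˢ b (suc _) = zeroʳ _

  -- Each term of the convolution splits bⁿ as bⁱ bⁿ⁻ⁱ. The recursion pulls one factor b out of the
  -- tail of f at a time.
  ▹-*ˢ : ∀ b f g n → (b ▹ f *ˢ b ▹ g) n ≈ (b ▹ (f *ˢ g)) n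
  ▹-*ˢ b f g zero    = solve 2 (λ u v → (con 1 :* u) :* (con 1 :* v) :+ con 0 := con 1 :* (u :* v :+ con 0)) refl _ _
  ▹-*ˢ b f g (suc n) = begin
    1# * f 0 * (b ^ suc n * g (suc n)) + (tail (b ▹ f) *ˢ b ▹ g) n
      ≈⟨ +-congˡ (*ˢ-cong′ {g = b ▹ g} (λ k → *-assoc b (b ^ k) (f (suc k))) (λ _ → refl) n) ⟩
    1# * f 0 * (b ^ suc n * g (suc n)) + ((λ k → b * (b ▹ tail f) k) *ˢ b ▹ g) n
      ≈⟨ +-congˡ (scale-*ˢ b (b ▹ tail f) (b ▹ g) n) ⟩
    1# * f 0 * (b ^ suc n * g (suc n)) + b * (b ▹ tail f *ˢ b ▹ g) n
      ≈⟨ +-congˡ (*-congˡ (▹-*ˢ b (tail f) g n)) ⟩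
    1# * f 0 * (b ^ suc n * g (suc n)) + b * (b ^ n * (tail f *ˢ g) n)
      ≈⟨ solve 5 (λ b p u v w → con 1 :* u :* ((b :* p) :* v) :+ b :* (p :* w) := (b :* p) :* (u :* v :+ w)) refl
           b (b ^ n) (f 0) (g (suc n)) _ ⟩
    b ^ suc n * (f 0 * g (suc n) + (tail f *ˢ g) n) ∎

-- The inversion identity in a ring that contains the roots.

-- If Q = ab then Φ p is the product of the factors 1 − a^(p−1−j) bʲ t for j < p.
module Rows (R : CommutativeRing c ℓ) (Q : CommutativeRing.Carrier R)
            (B : ℕ → ℕ → CommutativeRing.Carrier R) where

  open CommutativeRing R hiding (zero)

  Φ H : ℕ → PowerSeries.Series R
  Φ p i = weight R Q i * B p i
  H p m = B (m ℕ.+ p) p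

module SplitInversion (A : CommutativeRing c ℓ)
  {G : ℕ → CommutativeRing.Carrier A} {B : ℕ → ℕ → CommutativeRing.Carrier A}
  (triangle : IsBinomialTriangle A G B)
  {a b Q : CommutativeRing.Carrier A}
  (addition : AdditionFormula.HasAdditionFormula A a b G)
  (ab≈Q : CommutativeRing._≈_ A (CommutativeRing._*_ A a b) Q) where

  open CommutativeRing A hiding (zero)
  open Exp commutativeSemiring
  open SemiringSolver commutativeSemiring hiding (_:^_)
  open SetoidReasoning setoid
  open RingProperties ring using (-1*x≈-x)
  open PowerSeries A
  open SeriesLemmas A
  open IsBinomialTriangle triangle
  open BinomialTriangle A triangle
  open Rows A Q B

  private module S = CommutativeRing (PowerSeries.commutativeRing A)
  open RingLemmas (PowerSeries.commutativeRing A) using (cancel-factor)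

  Φ-zero : Φ 0 S.≈ 1ˢ
  Φ-zero = eqˢ λ
    { zero    → trans (*-identityˡ _) (B-zeroʳ 0)
    ; (suc i) → trans (*-congˡ (B-zero-suc i)) (zeroʳ _)
    }

  Φ-suc : ∀ p → Φ (suc p) S.≈ 1- a ^ p t S.* (b ▹ Φ p)
  Φ-suc p = eqˢ λ
    { zero → begin
        1# * B (suc p) 0                 ≈⟨ *-congˡ (trans (B-zeroʳ (suc p)) (sym (B-zeroʳ p))) ⟩
        1# * B p 0                       ≈⟨ solve 1 (λ u → con 1 :* u := con 1 :* (con 1 :* (con 1 :* u)) :+ con 0) refl _ ⟩
        1# * (1# * (1# * B p 0)) + 0#    ∎
    ; (suc i) → begin
        n * (Q ^ i * w i) * B (suc p) (suc i)
          -- Splitting Qⁱ = aⁱ bⁱ supplies the very factor aⁱ that the scaled Pascal rule asks for,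
          -- so no power of a has to be cancelled.
          ≈⟨ *-congʳ (*-congˡ (*-congʳ (Q^ i))) ⟩
        n * (a ^ i * b ^ i * w i) * B (suc p) (suc i)
          ≈⟨ solve 5 (λ n p q w u → n :* (p :* q :* w) :* u := n :* (q :* w) :* (p :* u)) refl
               n (a ^ i) (b ^ i) (w i) _ ⟩
        n * (b ^ i * w i) * (a ^ i * B (suc p) (suc i))
          ≈⟨ *-congˡ (pascal-scaled addition p i) ⟩
        n * (b ^ i * w i) * (a ^ i * (b ^ suc i * B p (suc i)) + a ^ p * B p i)
          ≈⟨ solve 8 (λ n q w r s u P v →
               n :* (q :* w) :* (r :* (s :* u) :+ P :* v) :=
               s :* (n :* (r :* q :* w) :* u) :+ n :* P :* (q :* (w :* v))) refl
               n (b ^ i) (w i) (a ^ i) (b ^ suc i) (B p (suc i)) (a ^ p) (B p i) ⟩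
        b ^ suc i * (n * (a ^ i * b ^ i * w i) * B p (suc i)) + n * a ^ p * (b ^ i * (w i * B p i))
          ≈⟨ +-congʳ (*-congˡ (*-congʳ (*-congˡ (*-congʳ (Q^ i))))) ⟨
        (b ▹ Φ p) (suc i) + n * a ^ p * (b ▹ Φ p) i
          ≈⟨ 1-at-*ˢ-suc (a ^ p) (b ▹ Φ p) i ⟨
        (1- a ^ p t *ˢ b ▹ Φ p) (suc i) ∎
    }
    where
    n = - 1#
    w = weight A Q
    Q^ : ∀ i → Q ^ i ≈ a ^ i * b ^ i
    Q^ i = trans (^-congˡ i (sym ab≈Q)) (^-distrib-* a b i)

  cancel-shifted : ∀ u v w → u ≈ v * w → u + - 1# * v * w ≈ 0#
  cancel-shifted u v w u≈vw = trans
    (+-cong u≈vw (trans (*-assoc _ _ _) (-1*x≈-x _))) (-‿inverseʳ _)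

  H-zero : 1- a ^ 0 t S.* H 0 S.≈ 1ˢ
  H-zero = eqˢ λ
    { zero    → trans (+-identityʳ _) (trans (*-identityˡ _) (B-zeroʳ 0))
    ; (suc m) → trans (1-at-*ˢ-suc 1# (H 0) m) (cancel-shifted _ _ _ (begin
        B (suc m ℕ.+ 0) 0  ≈⟨ trans (B-zeroʳ _) (sym (B-zeroʳ _)) ⟩
        B (m ℕ.+ 0) 0      ≈⟨ *-identityˡ _ ⟨
        1# * H 0 m         ∎))
    }

  -- Pascal's rule along a column: its a-term is the coefficient that multiplication by a^(p+1) t
  -- shifts up, so the difference leaves the b-term.
  H-suc : ∀ p → 1- a ^ suc p t S.* H (suc p) S.≈ b ▹ H p
  H-suc p = eqˢ λ
    -- Coefficient 0 receives nothing from the shift; correspondingly the a-term contains B(p,p+1) =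
    -- 0.
    { zero → begin
        1# * B (suc p) (suc p) + 0#
          ≈⟨ trans (+-identityʳ _) (*-identityˡ _) ⟩
        B (suc p) (suc p)
          ≈⟨ pascal addition 0 p ⟩
        a ^ suc p * B p (suc p) + 1# * B p p
          ≈⟨ +-congʳ (trans (*-congˡ (vanishing p (suc p) ℕ.≤-refl)) (zeroʳ _)) ⟩
        0# + 1# * B p p
          ≈⟨ +-identityˡ _ ⟩
        1# * B p p ∎
    ; (suc m) → begin
        (1- a ^ suc p t *ˢ H (suc p)) (suc m)
          ≈⟨ 1-at-*ˢ-suc (a ^ suc p) (H (suc p)) m ⟩
        B (suc m ℕ.+ suc p) (suc p) + - 1# * a ^ suc p * H (suc p) m
          ≈⟨ +-congʳ (trans (reflexive (≡.cong (λ n → B (suc n) (suc p)) (ℕ.+-suc m p)))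
                           (pascal addition (suc m) p)) ⟩
        a ^ suc p * B (suc m ℕ.+ p) (suc p) + b ^ suc m * H p (suc m) + - 1# * a ^ suc p * H (suc p) m
          ≈⟨ trans (+-congʳ (+-comm _ _)) (+-assoc _ _ _) ⟩
        b ^ suc m * H p (suc m) + (a ^ suc p * B (suc m ℕ.+ p) (suc p) + - 1# * a ^ suc p * H (suc p) m)
          ≈⟨ +-congˡ (cancel-shifted _ _ _
               (*-congˡ (reflexive (≡.cong (λ n → B n (suc p)) (≡.sym (ℕ.+-suc m p)))))) ⟩
        b ^ suc m * H p (suc m) + 0#
          ≈⟨ +-identityʳ _ ⟩
        b ^ suc m * H p (suc m) ∎
    }

  Φ*H : ∀ p → Φ (suc p) S.* H p S.≈ 1ˢ
  Φ*H zero = cancel-factor (Φ 1) 1- a ^ 0 t (b ▹ Φ 0) (H 0) 1ˢ (Φ-suc 0) H-zero (eqˢ λ n → begin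
    (b ▹ Φ 0 *ˢ 1ˢ) n  ≈⟨ *ˢ-comm (b ▹ Φ 0) 1ˢ n ⟩
    (1ˢ *ˢ b ▹ Φ 0) n  ≈⟨ *ˢ-identityˡ (b ▹ Φ 0) n ⟩
    b ^ n * Φ 0 n      ≈⟨ *-congˡ (coeff≈ Φ-zero n) ⟩
    b ^ n * 1ˢ n       ≈⟨ ▹-1ˢ b n ⟩
    1ˢ n               ∎)
  Φ*H (suc p) = cancel-factor (Φ (2 ℕ.+ p)) 1- a ^ suc p t (b ▹ Φ (suc p)) (H (suc p)) (b ▹ H p)
    (Φ-suc (suc p)) (H-suc p) (eqˢ λ n → begin
      (b ▹ Φ (suc p) *ˢ b ▹ H p) n    ≈⟨ ▹-*ˢ b (Φ (suc p)) (H p) n ⟩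
      b ^ n * (Φ (suc p) *ˢ H p) n    ≈⟨ *-congˡ (coeff≈ (Φ*H p) n) ⟩
      b ^ n * 1ˢ n                    ≈⟨ ▹-1ˢ b n ⟩
      1ˢ n                            ∎)

-- Transfer along homomorphisms and descent to the base ring.

module _ (R : CommutativeRing c ℓ) (S : CommutativeRing c′ ℓ′)
  {h : CommutativeRing.Carrier R → CommutativeRing.Carrier S} (isHomomorphism : IsHomomorphism R S h) where
  private
    module R = CommutativeRing R
    module Rᴾ = PowerSeries R
    module Sᴾ = PowerSeries S
  open CommutativeRing S hiding (zero)
  open Exp commutativeSemiring using (^-congˡ)
  open Homomorphism R S isHomomorphism
  open Regularity using (Regular)

  weight-homo : ∀ {Q Q′} → h Q ≈ Q′ → ∀ i → h (weight R Q i) ≈ weight S Q′ i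
  weight-homo hQ≈Q′ zero    = 1#-homo
  weight-homo hQ≈Q′ (suc i) = trans (*-homo _ _) (*-cong -1-homo
    (trans (*-homo _ _) (*-cong (trans (^-homo _ i) (^-congˡ i hQ≈Q′)) (weight-homo hQ≈Q′ i))))

  *ˢ-homo : ∀ f g n → h ((f Rᴾ.*ˢ g) n) ≈ ((h ∘ f) Sᴾ.*ˢ (h ∘ g)) n
  *ˢ-homo f g zero    = trans (+-homo _ _) (+-cong (*-homo _ _) 0#-homo)
  *ˢ-homo f g (suc n) = trans (+-homo _ _) (+-cong (*-homo _ _) (*ˢ-homo (f ∘ suc) g n))

  -- A homomorphism may send a regular element to a zero divisor, so preservation of regularity is a
  -- hypothesis here.
  triangle-homo : (∀ {u} → Regular R u → Regular S (h u)) → ∀ {G B} →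
    IsBinomialTriangle R G B → IsBinomialTriangle S (h ∘ G) (λ n k → h (B n k))
  triangle-homo regular-homo triangle = record
    { G-zero     = trans (⟦⟧-cong G-zero) 0#-homo
    ; G-regular  = λ n → regular-homo (G-regular n)
    ; B-zeroʳ    = λ n → trans (⟦⟧-cong (B-zeroʳ n)) 1#-homo
    ; B-zero-suc = λ k → trans (⟦⟧-cong (B-zero-suc k)) 0#-homo
    ; absorption = λ n k → trans (sym (*-homo _ _)) (trans (⟦⟧-cong (absorption n k)) (*-homo _ _))
    }
    where open IsBinomialTriangle triangle

module FibonacciInversion (R : CommutativeRing c ℓ) (x y : CommutativeRing.Carrier R)
  (f : ℕ → CommutativeRing.Carrier R) where

  open CommutativeRing R hiding (zero)
  open Exp commutativeSemiring using (_^_)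
  open PowerSeries R using (_*ˢ_; 1ˢ)

  module _
    (f0 : f 0 ≈ 0#) (f1 : f 1 ≈ 1#) (f-rec : ∀ n → f (suc (suc n)) ≈ x * f (suc n) + y * f n)
    (s : ℕ) {B : ℕ → ℕ → Carrier} (triangle : IsBinomialTriangle R (λ n → f (s ℕ.* n)) B) where

    private
      module E = QuadraticExtension R x y
      A = E.commutativeRing
      module A = CommutativeRing A
      module Aᴱ = Exp A.commutativeSemiring
      module h = Homomorphism R A E.embed-isHomomorphism

      a b Q′ : A.Carrier
      a  = E.α Aᴱ.^ s
      b  = E.β Aᴱ.^ s
      Q′ = (A.- A.1# A.* E.embed y) Aᴱ.^ s

      -- The product ab is symmetric in the roots and so lies in the base ring, which is why Φ can
      -- be formed there without a and b.
      Q : Carrier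
      Q = (- 1# * y) ^ s

      -y-homo : E.embed (- 1# * y) A.≈ A.- A.1# A.* E.embed y
      -y-homo = A.trans (h.*-homo (- 1#) y) (A.*-congʳ h.-1-homo)

      Q-homo : E.embed Q A.≈ Q′
      Q-homo = A.trans (h.^-homo (- 1# * y) s) (Aᴱ.^-congˡ s -y-homo)

      ab≈Q′ : a A.* b A.≈ Q′
      ab≈Q′ = A.trans (A.sym (Aᴱ.^-distrib-* E.α E.β s)) (Aᴱ.^-congˡ s (A.trans E.α*β -y-homo))

      open AdditionFormula A
      addition : HasAdditionFormula a b (λ n → E.embed (f (s ℕ.* n)))
      addition = dilate-addition (fibonacci-addition E.α+β (A.trans E.α*β -y-homo)
        (h.⟦⟧-cong f0) (h.⟦⟧-cong f1)
        (λ n → A.trans (h.⟦⟧-cong (f-rec n))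
                 (A.trans (h.+-homo _ _) (A.+-cong (h.*-homo _ _) (h.*-homo _ _))))) s

      module R-rows = Rows R Q B
      module A-rows = Rows A Q′ (λ n k → E.embed (B n k))

      Φ-homo : ∀ p i → E.embed (R-rows.Φ p i) A.≈ A-rows.Φ p i
      Φ-homo p i = A.trans (h.*-homo _ _) (A.*-congʳ (weight-homo R A E.embed-isHomomorphism Q-homo i))

    open R-rows public

    Φ*H : ∀ p n → (Φ (suc p) *ˢ H p) n ≈ 1ˢ n
    Φ*H p n = E.embed-injective (A.trans (*ˢ-homo R A E.embed-isHomomorphism (Φ (suc p)) (H p) n)
      (A.trans (PowerSeries.*ˢ-cong′ A {g = A-rows.H p} (Φ-homo (suc p)) (λ _ → A.refl) n)
      (A.trans (PowerSeries.coeff≈ (SplitInversion.Φ*H A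
                 (triangle-homo R A E.embed-isHomomorphism E.embed-regular triangle)
                 addition ab≈Q′ p) n)
               (1ˢ-homo n))))
      where
      1ˢ-homo : ∀ n → PowerSeries.1ˢ A n A.≈ E.embed (1ˢ n)
      1ˢ-homo zero    = A.refl
      1ˢ-homo (suc _) = A.refl

-- Fibopolynomials as a triangle of fractions.

module FractionLemmas (R : CommutativeRing c ℓ) where

  open CommutativeRing R hiding (zero)
  open SemiringSolver commutativeSemiring
  open Regularity R using (Regular; cancel-0)
  open Fractions R hiding (isCommutativeRing)
  private module Q = CommutativeRing (Fractions.commutativeRing R)

  opaque
    unfolding _+ᶠ_ _*ᶠ_ -ᶠ_

    fromRing-isHomomorphism : IsHomomorphism R (Fractions.commutativeRing R) fromRing
    fromRing-isHomomorphism = mkIsHomomorphism R (Fractions.commutativeRing R)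
      (λ p → eqᶠ (*-congʳ p))
      (λ u v → eqᶠ (solve 2 (λ u v → (u :+ v) :* (con 1 :* con 1) := (u :* con 1 :+ v :* con 1) :* con 1) refl u v))
      (eqᶠ refl)
      (λ u v → eqᶠ (solve 2 (λ u v → (u :* v) :* (con 1 :* con 1) := (u :* v) :* con 1) refl u v))
      (eqᶠ refl)
      (λ u → eqᶠ refl)

    fromRing-regular : ∀ {u} → Regular u → Regularity.Regular (Fractions.commutativeRing R) (fromRing u)
    fromRing-regular {u} ru .Regularity.cancel-0 (v / w [ _ ]) (eqᶠ uv≈0) = eqᶠ (trans (*-identityʳ v)
      (trans (cancel-0 ru v (trans (sym (*-identityʳ _)) (trans uv≈0 (zeroˡ _)))) (sym (zeroˡ w))))

    reciprocal : ∀ {u} (ru : Regular u) → (1# / u [ ru ]) Q.* fromRing u Q.≈ Q.1#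
    reciprocal {u} ru = eqᶠ (solve 1 (λ u → (con 1 :* u) :* con 1 := con 1 :* (u :* con 1)) refl u)

    -- Absorption for quotients of products: passing to the next entry adds g′ to the numerator and
    -- g to the denominator.
    cross-absorption : ∀ g g′ n n′ d d′ (rd : Regular d) (rd′ : Regular d′) →
      n′ ≈ g′ * n → d′ ≈ g * d →
      fromRing g Q.* (n′ / d′ [ rd′ ]) Q.≈ fromRing g′ Q.* (n / d [ rd ])
    cross-absorption g g′ n n′ d d′ _ _ n′≈ d′≈ = eqᶠ (trans
      (*-congʳ (*-congˡ n′≈))
      (trans
        (solve 4 (λ g g′ n d → (g :* (g′ :* n)) :* (con 1 :* d) := (g′ :* n) :* (con 1 :* (g :* d))) refl g g′ n d)
        (*-congˡ (*-congˡ (sym d′≈)))))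

module ProductLemmas (R : CommutativeRing c ℓ) where

  open CommutativeRing R hiding (zero)
  open MonoidSum *-monoid using () renaming
    (sum to product; sum-init-last to product-init-last; sum-cong-≗ to product-cong)

  product-cons : ∀ (g : ℕ → Carrier) k → product {suc k} (g ∘ toℕ) ≈ g 0 * product {k} (g ∘ suc ∘ toℕ)
  product-cons g k = refl

  -- Numerators gain their new factor at the front, denominators at the end; hence the two forms.
  product-snoc : ∀ (g : ℕ → Carrier) k → product {suc k} (g ∘ toℕ) ≈ g k * product {k} (g ∘ toℕ)
  product-snoc g k = trans
    (trans (product-init-last {k} (g ∘ toℕ))
      (reflexive (≡.cong₂ _*_ (product-cong {k} λ j → ≡.cong g (Fin.toℕ-inject₁ j)) (≡.cong g (Fin.toℕ-fromℕ k)))))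
    (*-comm _ _)

module FibopolynomialTriangle (K : CommutativeRing c ℓ) (s : ℕ) .{{_ : NonZero s}} where

  open Fibopolynomials K
  private
    module P = CommutativeRing K[x,y]
    module Q = CommutativeRing K⟨x,y⟩
    module h = Homomorphism K[x,y] K⟨x,y⟩ (FractionLemmas.fromRing-isHomomorphism K[x,y])
  open Exp Q.commutativeSemiring using (_^_)
  open Fractions K[x,y] using (fromRing; _/_[_])
  open FractionLemmas K[x,y]
  open PowerSeries K⟨x,y⟩ using (_*ˢ_; 1ˢ)

  fib : ℕ → Q.Carrier
  fib n = fromRing (F n)

  private
    numerator-cons : ∀ n k → numerator s (suc n) (suc k) P.≈ F (s ℕ.* suc n) P.* numerator s n k
    numerator-cons n k = ProductLemmas.product-cons K[x,y] (λ j → F (s ℕ.* (suc n ∸ j))) k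

    denominator-snoc : ∀ k → denominator s (suc k) P.≈ F (s ℕ.* suc k) P.* denominator s k
    denominator-snoc = ProductLemmas.product-snoc K[x,y] (λ j → F (s ℕ.* suc j))

    -- A with-abstraction over the guard would normalise the nested polynomial rings.
    when-defined : ∀ n k defined →
      fib (s ℕ.* suc k) Q.* (if defined
        then numerator s (suc n) (suc k) / denominator s (suc k) [ denominator-regular s (suc k) ]
        else fromRing P.0#) Q.≈
      fib (s ℕ.* suc n) Q.* (if defined
        then numerator s n k / denominator s k [ denominator-regular s k ]
        else fromRing P.0#)
    when-defined n k true  = cross-absorption (F (s ℕ.* suc k)) (F (s ℕ.* suc n))
      (numerator s n k) (numerator s (suc n) (suc k)) (denominator s k) (denominator s (suc k))
      (denominator-regular s k) (denominator-regular s (suc k))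
      (numerator-cons n k) (denominator-snoc k)
    when-defined n k false = Q.trans (Q.zeroʳ (fib (s ℕ.* suc k))) (Q.sym (Q.zeroʳ (fib (s ℕ.* suc n))))

  triangle : IsBinomialTriangle K⟨x,y⟩ (λ n → fib (s ℕ.* n)) (fibopolynomial s)
  triangle = record
    { G-zero     = Q.reflexive (≡.cong fib (ℕ.*-zeroʳ s))
    ; G-regular  = λ n → fromRing-regular (F-regular (s ℕ.* suc n) {{ℕ.m*n≢0 s (suc n)}})
    ; B-zeroʳ    = λ n → Fractions.eqᶠ P.refl
    ; B-zero-suc = λ k → Q.refl
    ; absorption = absorption
    }
    where
    absorption : ∀ n k → fib (s ℕ.* suc k) Q.* fibopolynomial s (suc n) (suc k) Q.≈
                         fib (s ℕ.* suc n) Q.* fibopolynomial s n k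
    -- The guards of the two entries reduce to the same boolean: `true` in column zero, `k <ᵇ n` in
    -- the others.
    absorption n zero    = when-defined n 0 true
    absorption n (suc k) = when-defined n (suc k) (k ℕ.<ᵇ n)

  fib-suc-suc : ∀ n → fib (suc (suc n)) Q.≈ fromRing x Q.* fib (suc n) Q.+ fromRing y Q.* fib n
  fib-suc-suc n = Q.trans (h.+-homo _ _) (Q.+-cong (h.*-homo _ _) (h.*-homo _ _))

  open Rows K⟨x,y⟩ ((Q.- Q.1# Q.* fromRing y) ^ s) (fibopolynomial s)

  Φ*H : ∀ p n → (Φ (suc p) *ˢ H p) n Q.≈ 1ˢ n
  Φ*H = FibonacciInversion.Φ*H K⟨x,y⟩ (fromRing x) (fromRing y) fib Q.refl Q.refl fib-suc-suc s triangle

-- Exponents and signs.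

module Exponents where

  open import Data.Nat.Base using (_+_; _*_)
  open ℕ-Solver.+-*-Solver

  -- The exponents of the theorem by their increments 2s + 1 + si and si, free of halving. The
  -- summand `s + s` stands apart because it is even and drops out of the sign.
  sign-exponent y-exponent : ℕ → ℕ → ℕ
  sign-exponent s zero    = s + 1
  sign-exponent s (suc i) = sign-exponent s i + ((s + s) + suc (s * i))
  y-exponent s zero    = 0
  y-exponent s (suc i) = y-exponent s i + s * i

  -- Each numerator is shown to be exactly twice the recursive exponent, so the floor division loses
  -- nothing.
  halve : ∀ m {n} → m * 2 ≡ n → n / 2 ≡ m
  halve m ≡.refl = m*n/n≡m m 2

  sign-exponent-closed : ∀ s i → ((s * i + 2 * (s + 1)) * (i + 1)) / 2 ≡ sign-exponent s i
  sign-exponent-closed s i = halve (sign-exponent s i) (double i)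
    where
    double : ∀ i → sign-exponent s i * 2 ≡ (s * i + 2 * (s + 1)) * (i + 1)
    double zero    = solve 1 (λ s → (s :+ con 1) :* con 2 :=
      (s :* con 0 :+ con 2 :* (s :+ con 1)) :* (con 0 :+ con 1)) ≡.refl s
    double (suc i) = ≡.trans (ℕ.*-distribʳ-+ 2 (sign-exponent s i) ((s + s) + suc (s * i)))
      (≡.trans (≡.cong (λ k → k + ((s + s) + suc (s * i)) * 2) (double i))
        (solve 2 (λ s i → (s :* i :+ con 2 :* (s :+ con 1)) :* (i :+ con 1)
            :+ ((s :+ s) :+ (con 1 :+ s :* i)) :* con 2 :=
          (s :* (con 1 :+ i) :+ con 2 :* (s :+ con 1)) :* (con 1 :+ i :+ con 1)) ≡.refl s i))

  y-exponent-closed : ∀ s i → (s * i * (i ∸ 1)) / 2 ≡ y-exponent s i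
  y-exponent-closed s i = halve (y-exponent s i) (double i)
    where
    double : ∀ i → y-exponent s i * 2 ≡ s * i * (i ∸ 1)
    double zero          = ≡.sym (ℕ.*-zeroʳ (s * 0))
    -- Separating 0 and 1 resolves the truncated i ∸ 1, which is no polynomial for the solver.
    double (suc zero)    = solve 1 (λ s → (s :* con 0) :* con 2 := s :* con 1 :* con 0) ≡.refl s
    double (suc (suc i)) = ≡.trans (ℕ.*-distribʳ-+ 2 (y-exponent s (suc i)) (s * suc i))
      (≡.trans (≡.cong (λ k → k + s * suc i * 2) (double (suc i)))
        (solve 2 (λ s i → s :* (con 1 :+ i) :* i :+ s :* (con 1 :+ i) :* con 2 :=
          s :* (con 2 :+ i) :* (con 1 :+ i)) ≡.refl s i))

module Sign (R : CommutativeRing c ℓ) where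

  open CommutativeRing R hiding (zero)
  open Exp commutativeSemiring
  open SemiringSolver commutativeSemiring hiding (_:^_)
  open SetoidReasoning setoid
  open RingProperties ring using (-1*x≈-x; -‿involutive)
  open Exponents

  sign-square : ∀ n → (- 1#) ^ n * (- 1#) ^ n ≈ 1#
  sign-square zero    = *-identityˡ 1#
  sign-square (suc n) = begin
    - 1# * (- 1#) ^ n * (- 1# * (- 1#) ^ n)      ≈⟨ solve 2 (λ m p → m :* p :* (m :* p) := (m :* m) :* (p :* p)) refl (- 1#) _ ⟩
    - 1# * - 1# * ((- 1#) ^ n * (- 1#) ^ n)      ≈⟨ *-cong (trans (-1*x≈-x (- 1#)) (-‿involutive 1#)) (sign-square n) ⟩
    1# * 1#                                      ≈⟨ *-identityˡ 1# ⟩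
    1#                                           ∎

  private
    -- One step multiplies the left side by (-1)^(2s+1+si) y^(si). Since (-1)^(2s) = 1 and (-y)^(si)
    -- = Qⁱ, this is -Qⁱ, the step of `weight`; the prefactor is the value at i = 0.
    weight-power : ∀ s y i →
      (- 1#) ^ sign-exponent s i * y ^ y-exponent s i ≈ (- 1#) ^ (s ℕ.+ 1) * weight R ((- 1# * y) ^ s) i
    weight-power s y zero    = refl
    weight-power s y (suc i) = begin
      n ^ (sign-exponent s i ℕ.+ ((s ℕ.+ s) ℕ.+ suc (s ℕ.* i))) * y ^ (y-exponent s i ℕ.+ s ℕ.* i)
        ≈⟨ *-cong (trans (^-homo-* n (sign-exponent s i) _) (*-congˡ (trans (^-homo-* n (s ℕ.+ s) _)
             (trans (*-congʳ (trans (^-homo-* n s s) (sign-square s))) (*-identityˡ _)))))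
             (^-homo-* y (y-exponent s i) _) ⟩
      n ^ sign-exponent s i * (n * n ^ (s ℕ.* i)) * (y ^ y-exponent s i * y ^ (s ℕ.* i))
        ≈⟨ solve 5 (λ E n p Y q → E :* (n :* p) :* (Y :* q) := n :* (p :* q) :* (E :* Y)) refl
             (n ^ sign-exponent s i) n (n ^ (s ℕ.* i)) (y ^ y-exponent s i) (y ^ (s ℕ.* i)) ⟩
      n * (n ^ (s ℕ.* i) * y ^ (s ℕ.* i)) * (n ^ sign-exponent s i * y ^ y-exponent s i)
        ≈⟨ *-cong (*-congˡ (trans (sym (^-distrib-* n y (s ℕ.* i))) (sym (^-assocʳ (n * y) s i))))
                  (weight-power s y i) ⟩
      n * Q ^ i * (n ^ (s ℕ.+ 1) * weight R Q i)
        ≈⟨ solve 4 (λ n q σ w → n :* q :* (σ :* w) := σ :* (n :* (q :* w))) refl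
             n (Q ^ i) (n ^ (s ℕ.+ 1)) (weight R Q i) ⟩
      n ^ (s ℕ.+ 1) * (n * (Q ^ i * weight R Q i)) ∎
      where
      n = - 1#
      Q = (n * y) ^ s

  signed-power : ∀ s y i →
    (- 1#) ^ (((s ℕ.* i ℕ.+ 2 ℕ.* (s ℕ.+ 1)) ℕ.* (i ℕ.+ 1)) / 2) * y ^ ((s ℕ.* i ℕ.* (i ∸ 1)) / 2) ≈
    (- 1#) ^ (s ℕ.+ 1) * weight R ((- 1# * y) ^ s) i
  signed-power s y i = trans
    (reflexive (≡.cong₂ (λ j k → (- 1#) ^ j * y ^ k) (sign-exponent-closed s i) (y-exponent-closed s i)))
    (weight-power s y i)

-- The denominator and the transform as Laurent series.

module Denominator (L : CommutativeRing c ℓ) where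

  open CommutativeRing L hiding (zero)
  open Exp commutativeSemiring
  open SemiringSolver commutativeSemiring hiding (_:^_)
  open SetoidReasoning setoid
  open SemiringSum semiring using (sum; sum-cong-≋; *-distribˡ-sum)
  open Sign L

  -- N bounds the sum and q is the degree in z. They have equal values in use, but the theorem
  -- writes them as `suc p` and `p + 1`.
  denominator : (s : ℕ) (Y z : Carrier) (N q : ℕ) (b : ℕ → Carrier) → Carrier
  denominator s Y z N q b = sum {suc N} λ i →
      (- 1#) ^ (((s ℕ.* toℕ i ℕ.+ 2 ℕ.* (s ℕ.+ 1)) ℕ.* (toℕ i ℕ.+ 1)) / 2)
    * b (toℕ i)
    * Y ^ ((s ℕ.* toℕ i ℕ.* (toℕ i ∸ 1)) / 2)
    * z ^ (q ∸ toℕ i)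

  module _ {z τ : Carrier} (zτ≈1 : z * τ ≈ 1#) where

    z^*τ^ : ∀ n → z ^ n * τ ^ n ≈ 1#
    z^*τ^ n = trans (sym (^-distrib-* z τ n)) (trans (^-congˡ n zτ≈1) (1^ n))
      where
      1^ : ∀ n → 1# ^ n ≈ 1#
      1^ zero    = refl
      1^ (suc n) = trans (*-identityˡ _) (1^ n)

    -- This turns descending powers of z into ascending powers of τ = z⁻¹; i ≤ N keeps the
    -- subtraction from truncating.
    z^∸ : ∀ {i N} → i ℕ.≤ N → z ^ (N ∸ i) ≈ z ^ N * τ ^ i
    z^∸ {i} {N} i≤N = begin
      z ^ (N ∸ i)                    ≈⟨ *-identityʳ _ ⟨
      z ^ (N ∸ i) * 1#               ≈⟨ *-congˡ (z^*τ^ i) ⟨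
      z ^ (N ∸ i) * (z ^ i * τ ^ i)  ≈⟨ *-assoc _ _ _ ⟨
      z ^ (N ∸ i) * z ^ i * τ ^ i    ≈⟨ *-congʳ (^-homo-* z (N ∸ i) i) ⟨
      z ^ (N ∸ i ℕ.+ i) * τ ^ i      ≡⟨ ≡.cong (λ n → z ^ n * τ ^ i) (ℕ.m∸n+n≡m i≤N) ⟩
      z ^ N * τ ^ i                  ∎

    denominator-polynomial : ∀ s Y N b →
      denominator s Y z N N b ≈
      (- 1#) ^ (s ℕ.+ 1) * z ^ N * sum {suc N} (λ i → weight L ((- 1# * Y) ^ s) (toℕ i) * b (toℕ i) * τ ^ toℕ i)
    denominator-polynomial s Y N b = trans
      (sum-cong-≋ {suc N} λ i → term (toℕ i) (ℕ.s≤s⁻¹ (Fin.toℕ<n i)))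
      (sym (*-distribˡ-sum {suc N} (σ * z ^ N) (λ i → w (toℕ i) * b (toℕ i) * τ ^ toℕ i)))
      where
      σ = (- 1#) ^ (s ℕ.+ 1)
      w = weight L ((- 1# * Y) ^ s)
      term : ∀ i → i ℕ.≤ N → _ ≈ σ * z ^ N * (w i * b i * τ ^ i)
      term i i≤N = begin
        E * b i * V * z ^ (N ∸ i)
          ≈⟨ *-congˡ (z^∸ i≤N) ⟩
        E * b i * V * (z ^ N * τ ^ i)
          ≈⟨ solve 5 (λ E b V Z T → E :* b :* V :* (Z :* T) := (E :* V) :* b :* Z :* T) refl
               E (b i) V (z ^ N) (τ ^ i) ⟩
        (E * V) * b i * z ^ N * τ ^ i
          ≈⟨ *-congʳ (*-congʳ (*-congʳ (signed-power s Y i))) ⟩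
        (σ * w i) * b i * z ^ N * τ ^ i
          ≈⟨ solve 5 (λ σ w b Z T → (σ :* w) :* b :* Z :* T := σ :* Z :* (w :* b :* T)) refl
               σ (w i) (b i) (z ^ N) (τ ^ i) ⟩
        σ * z ^ N * (w i * b i * τ ^ i) ∎
        where
        E = (- 1#) ^ (((s ℕ.* i ℕ.+ 2 ℕ.* (s ℕ.+ 1)) ℕ.* (i ℕ.+ 1)) / 2)
        V = Y ^ ((s ℕ.* i ℕ.* (i ∸ 1)) / 2)

    -- Since f g = 1 and z τ = 1, D Z collapses to σ z with σ = (-1)^(s+1). As σ² = 1, multiplying
    -- by σ τ gives 1.
    quotient : ∀ s p {D Z f g} → f * g ≈ 1# →
      D ≈ (- 1#) ^ (s ℕ.+ 1) * z ^ suc p * f → Z ≈ τ ^ p * g →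
      Σ[ D⁻¹ ∈ Invertible _≈_ 1# _*_ D ] Z ≈ ((- 1#) ^ (s ℕ.+ 1) * z) * proj₁ D⁻¹
    quotient s p {D} {Z} {f} {g} fg≈1 D≈ Z≈ =
      -- The inverse of D is the transform Z times the unit σ τ.
      (σ * τ * Z , trans (*-comm _ _) D*D⁻¹ , D*D⁻¹) , (begin
        Z                         ≈⟨ solve 1 (λ u → u := con 1 :* con 1 :* u) refl Z ⟩
        1# * 1# * Z               ≈⟨ *-congʳ (*-cong (sign-square (s ℕ.+ 1)) zτ≈1) ⟨
        (σ * σ) * (z * τ) * Z     ≈⟨ solve 4 (λ σ z τ u → (σ :* σ) :* (z :* τ) :* u := (σ :* z) :* (σ :* τ :* u)) refl σ z τ Z ⟩
        (σ * z) * (σ * τ * Z)     ∎)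
      where
      σ = (- 1#) ^ (s ℕ.+ 1)
      D*D⁻¹ : D * (σ * τ * Z) ≈ 1#
      D*D⁻¹ = begin
        D * (σ * τ * Z)
          ≈⟨ *-cong D≈ (*-congˡ Z≈) ⟩
        σ * (z * z ^ p) * f * (σ * τ * (τ ^ p * g))
          ≈⟨ solve 7 (λ σ z P f τ T g →
               σ :* (z :* P) :* f :* (σ :* τ :* (T :* g)) := (σ :* σ) :* (z :* τ) :* (P :* T) :* (f :* g)) refl
               σ z (z ^ p) f τ (τ ^ p) g ⟩
        (σ * σ) * (z * τ) * (z ^ p * τ ^ p) * (f * g)
          ≈⟨ *-cong (*-cong (*-cong (sign-square (s ℕ.+ 1)) zτ≈1) (z^*τ^ p)) fg≈1 ⟩
        1# * 1# * 1# * 1#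
          ≈⟨ solve 0 (con 1 :* con 1 :* con 1 :* con 1 := con 1) refl ⟩
        1# ∎

module ZTransform (R : CommutativeRing c ℓ) (s : ℕ) (y : CommutativeRing.Carrier R)
  {G : ℕ → CommutativeRing.Carrier R} {B : ℕ → ℕ → CommutativeRing.Carrier R}
  (triangle : IsBinomialTriangle R G B) where

  open LaurentSeries R using (𝓩; z; scalar)
  private
    S = PowerSeries.commutativeRing R
    L = LaurentSeries.commutativeRing R
    module R = CommutativeRing R
    module S = CommutativeRing S
    module L = CommutativeRing L
    module Rᴱ = Exp R.commutativeSemiring
    module Sᴱ = Exp S.commutativeSemiring
    module Lᴱ = Exp L.commutativeSemiring
    module Sˢ = SemiringSum S.semiring
    module Lˢ = SemiringSum L.semiring
    module P = PowerSeries R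
    module SL = SeriesLemmas R
    module D = Denominator L
    fromSeries-isHomomorphism = FractionLemmas.fromRing-isHomomorphism S
    scalar-isHomomorphism : IsHomomorphism R L scalar
    scalar-isHomomorphism = Composition.isRingHomomorphism L.trans SL.constant-isHomomorphism fromSeries-isHomomorphism
    module c = Homomorphism R L scalar-isHomomorphism
    module h = Homomorphism S L fromSeries-isHomomorphism

    Q : R.Carrier
    Q = (R.- R.1# R.* y) Rᴱ.^ s

    τ : L.Carrier
    τ = 𝓩 P.t

    zτ≈1 : z L.* τ L.≈ L.1#
    zτ≈1 = FractionLemmas.reciprocal S (SeriesRegularity.t-regular R)

  open Rows R Q B
  open BinomialTriangle R triangle

  private
    -- Row N of the triangle vanishes beyond column N, so the series Φ N is a finite sum that
    -- survives the passage to Laurent series.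
    polynomial : ∀ N → 𝓩 (Φ N) L.≈ Lˢ.sum {suc N} λ i →
      weight L ((L.- L.1# L.* scalar y) Lᴱ.^ s) (toℕ i) L.* scalar (B N (toℕ i)) L.* τ Lᴱ.^ toℕ i
    polynomial N = L.trans
      (h.⟦⟧-cong (SL.finite-series (suc N) (Φ N) λ i N<i → R.trans (R.*-congˡ (vanishing N i N<i)) (R.zeroʳ _)))
      (L.trans (h.sum-homo {suc N} λ i → P.constant (Φ N (toℕ i)) S.* P.t Sᴱ.^ toℕ i)
      (Lˢ.sum-cong-≋ {suc N} λ i → L.trans (h.*-homo (P.constant (Φ N (toℕ i))) (P.t Sᴱ.^ toℕ i))
        (L.*-cong
          (L.trans (c.*-homo (weight R Q (toℕ i)) (B N (toℕ i)))
            (L.*-congʳ (weight-homo R L scalar-isHomomorphism Q-homo (toℕ i))))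
          (h.^-homo P.t (toℕ i)))))
      where
      Q-homo : scalar Q L.≈ (L.- L.1# L.* scalar y) Lᴱ.^ s
      Q-homo = L.trans (c.^-homo _ s) (Lᴱ.^-congˡ s (L.trans (c.*-homo _ y) (L.*-congʳ c.-1-homo)))

    column : ∀ p → 𝓩 (λ n → B n p) L.≈ τ Lᴱ.^ p L.* 𝓩 (H p)
    column p = L.trans (h.⟦⟧-cong (SL.factor-t^ p (λ n → B n p) λ n n<p → vanishing n p n<p))
      (L.trans (h.*-homo (P.t Sᴱ.^ p) (λ m → B (p ℕ.+ m) p))
        (L.*-cong (h.^-homo P.t p)
          (h.⟦⟧-cong {λ m → B (p ℕ.+ m) p} {H p}
            (P.eqˢ λ m → R.reflexive (≡.cong (λ n → B n p) (ℕ.+-comm p m))))))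

  -- The index q stands for the theorem's p + 1, which does not reduce to `suc p`; matching on the
  -- equation identifies the two.
  column-transform : (∀ p n → (Φ (suc p) P.*ˢ H p) n R.≈ P.1ˢ n) → ∀ p q → suc p ≡ q →
    let D = D.denominator s (scalar y) z (suc p) q (λ i → scalar (B q i))
    in Σ[ D⁻¹ ∈ Invertible L._≈_ L.1# L._*_ D ]
         𝓩 (λ n → B n p) L.≈ ((L.- L.1#) Lᴱ.^ (s ℕ.+ 1) L.* z) L.* proj₁ D⁻¹
  column-transform Φ*H≈1 p .(suc p) ≡.refl = D.quotient zτ≈1 s p
    (L.trans (L.sym (h.*-homo (Φ (suc p)) (H p))) (h.⟦⟧-cong {Φ (suc p) P.*ˢ H p} {P.1ˢ} (P.eqˢ (Φ*H≈1 p))))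
    (L.trans (D.denominator-polynomial zτ≈1 s (scalar y) (suc p) (λ i → scalar (B (suc p) i)))
      (L.*-congˡ (L.sym (polynomial (suc p)))))
    (column p)

open Defs

-- Division by D is multiplication by an inverse whose existence is part of the claim. Inverses in a
-- commutative ring are unique, so the quotient is well determined.
corollary8 : (s : ℕ) .{{_ : NonZero s}} (p : ℕ) →
  let D = ∑[ i ≤ suc p ]
            ( (- 1#) ^ (((s ℕ.* toℕ i ℕ.+ 2 ℕ.* (s ℕ.+ 1)) ℕ.* (toℕ i ℕ.+ 1)) / 2)
            * scalar (fibopolynomial s (p ℕ.+ 1) (toℕ i))
            * scalar (fromRing y) ^ ((s ℕ.* toℕ i ℕ.* (toℕ i ∸ 1)) / 2)
            * z ^ ((p ℕ.+ 1) ∸ toℕ i) )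
  in Σ[ D⁻¹ ∈ Invertible _≈_ 1# _*_ D ]
       𝓩 (λ n → fibopolynomial s n p) ≈ ((- 1#) ^ (s ℕ.+ 1) * z) * proj₁ D⁻¹
corollary8 s {{s≢0}} p = ZTransform.column-transform (Fibopolynomials.K⟨x,y⟩ ℂ-commutativeRing) s (fromRing y)
  triangle Φ*H p (p ℕ.+ 1) (ℕ.+-comm 1 p)
  where open FibopolynomialTriangle ℂ-commutativeRing s {{s≢0}}
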